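{- For all integers $r \ge 2$ and $a \ge r+2$, $[\mathcal{K}_r(a)] = \{J_r(a,t) : 0 \le t \le \lfloor r/2 \rfloor\}$; that is, a graph $H$ satisfies $D(H,x) = D(\mathcal{K}_r(a),x)$ if and only if $H \cong J_r(a,t)$ for some integer $t$ with $0 \le t \le \lfloor r/2 \rfloor$.
   Context: All graphs are finite and simple, and $\mathbb{N}$ denotes the positive integers. For a graph $G=(V,E)$, $v(G)=|V|$, and $N[v]$ denotes the closed neighborhood of a vertex $v$ (i.e. $v$ together with all its neighbors). A set $S \subseteq V$ is a dominating set of $G$ if $\bigcup_{x\in S} N[x] = V$. Let $d(G,i)$ be the number of dominating sets of $G$ of cardinality $i$. The domination polynomial of $G$ is $D(G,x)=\sum_{i=1}^{v(G)} d(G,i)\, x^i$. Two graphs $G,H$ are $\mathcal{D}$-equivalent if $D(G,x)=D(H,x)$, and $[G]$ denotes the $\mathcal{D}$-equivalence class of $G$, with graphs considered up to isomorphism. For $r \in \mathbb{N}$ and $a\in\mathbb{N}$, $\mathcal{K}_r(a)$ denotes the complete $r$-partite graph all of whose $r$ color classes have size $a$; $\mathcal{K}_1(a)$ is the graph on $a$ vertices with no edges, and $\mathcal{K}_0(a)$ is defined to be the empty graph $\mathcal{E}$ with no vertices and no edges. For vertex-disjoint graphs $G$ and $H$, the join $G\vee H$ is the union of $G$ and $H$ together with all edges between $V(G)$ and $V(H)$ (so $G \vee \mathcal{E} = G$); the join $\bigvee_{i=1}^k G_i = G_1\vee\cdots\vee G_k$ of several vertex-disjoint graphs is defined analogously (an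 empty join being $\mathcal{E}$). For $a \in\mathbb{N}$, $H_0(a)$ is the graph on $2a$ vertices formed by two disjoint copies of the complete graph $K_a$ connected by a perfect matching between them (equivalently, the Cartesian product of $K_a$ and $K_2$). For $r\ge 2$ and $0\le t\le \lfloor r/2\rfloor$, $J_r(a,t)$ is the graph on $a\cdot r$ vertices given by $J_r(a,t) = \left(\bigvee_{i=1}^t H_i\right)\vee \mathcal{K}_{r-2t}(a)$, where $H_1,\ldots,H_t$ are vertex-disjoint copies of $H_0(a)$; in particular $J_r(a,0)=\mathcal{K}_r(a)$. -}

module Defs where

open import Level using (0ℓ)
open import Data.Empty using (⊥)
open import Data.Unit using (⊤; tt)
open import Data.Nat.Base using (ℕ; zero; suc; _+_; _*_; _∸_)
import Data.Nat.Properties as ℕ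
open import Data.Fin.Base using (Fin; splitAt; quotient; remainder)
open import Data.Fin.Properties using (_≟_; any?; all?)
open import Data.Fin.Subset using (Subset; inside; outside; _∈_; ∣_∣)
open import Data.Fin.Subset.Properties using (_∈?_)
open import Data.List.Base using (List; []; _∷_; _++_; map; filter; length; foldr; replicate; applyUpTo)
open import Data.Product.Base using (_×_; _,_; Σ-syntax; ∃-syntax)
open import Data.Sum.Base as Sum using (_⊎_; inj₁; inj₂)
open import Data.Vec.Base as Vec using ()
open import Function.Bundles using (_⇔_; _↔_; Inverse)
open import Relation.Binary.Core using (Rel)
open import Relation.Binary.Definitions using (Symmetric; Irreflexive; Decidable)
open import Relation.Binary.PropositionalEquality.Core using (_≡_; _≢_; refl; sym; ≢-sym)
open import Relation.Nullary.Decidable using (Dec; yes; no; ¬?; _×-dec_; _⊎-dec_)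
import Relation.Unary as U

-- Since graphs are considered up to isomorphism, the vertex set is some Fin n.
record Graph : Set₁ where
  field
    order  : ℕ
    Adj    : Rel (Fin order) 0ℓ
    symm   : Symmetric Adj
    irrefl : Irreflexive _≡_ Adj
    adj?   : Decidable Adj

  Vertex : Set
  Vertex = Fin order

  N[_] : Vertex → U.Pred Vertex 0ℓ
  N[ x ] v = v ≡ x ⊎ Adj x v

  Dominating : U.Pred (Subset order) 0ℓ
  Dominating S = ∀ v → ∃[ x ] (x ∈ S × N[ x ] v)

  dominating? : U.Decidable Dominating
  dominating? S = all? λ v → any? λ x → (x ∈? S) ×-dec ((v ≟ x) ⊎-dec adj? x v)

open Graph

infix 4 _≅_ _≋_ _∼ᴰ_

_≅_ : Graph → Graph → Set
G ≅ H = Σ[ f ∈ Vertex G ↔ Vertex H ]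
          (∀ x y → Adj G x y ⇔ Adj H (Inverse.to f x) (Inverse.to f y))

-- Every subset of Fin n, listed exactly once.
subsets : ∀ n → List (Subset n)
subsets zero    = Vec.[] ∷ []
subsets (suc n) = map (inside Vec.∷_) (subsets n) ++ map (outside Vec.∷_) (subsets n)

d : Graph → ℕ → ℕ
d G i = length (filter (λ S → dominating? G S ×-dec (∣ S ∣ ℕ.≟ i)) (subsets (order G)))

-- Polynomials as coefficient lists, constant term first; trailing zeros are
-- allowed, so equality is equality of all coefficients.
Poly : Set
Poly = List ℕ

coeff : Poly → ℕ → ℕ
coeff []       _       = 0
coeff (c ∷ cs) zero    = c
coeff (c ∷ cs) (suc i) = coeff cs i

_≋_ : Rel Poly 0ℓ
p ≋ q = ∀ i → coeff p i ≡ coeff q i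

-- The coefficients 0, d(G,1), …, d(G,v(G)): the sum starts at i = 1.
D : Graph → Poly
D G = 0 ∷ applyUpTo (λ i → d G (suc i)) (order G)

_∼ᴰ_ : Graph → Graph → Set
G ∼ᴰ H = D G ≋ D H

-- The 𝒟-equivalence class of G; membership respects _≅_.
[_] : Graph → U.Pred Graph 0ℓ
[ G ] H = H ∼ᴰ G

ℰ : Graph
ℰ = record
  { order  = 0
  ; Adj    = λ _ _ → ⊥
  ; symm   = λ ()
  ; irrefl = λ _ ()
  ; adj?   = λ ()
  }

-- Vertex i lies in colour class quotient a i; there are r classes of size a.
-- For r = 1 there are no edges and for r = 0 no vertices.
𝒦 : ℕ → ℕ → Graph
𝒦 r a = record
  { order  = r * a
  ; Adj    = λ i j → class i ≢ class j
  ; symm   = ≢-sym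
  ; irrefl = λ { refl i≢i → i≢i refl }
  ; adj?   = λ i j → ¬? (class i ≟ class j)
  }
  where
  class : Fin (r * a) → Fin r
  class = quotient a

-- Vertex i is the vertex pos i of K_a in the copy numbered copy i. The first
-- alternative gives the two copies of K_a, the second the perfect matching.
H₀ : ℕ → Graph
H₀ a = record
  { order  = 2 * a
  ; Adj    = λ i j → (copy i ≡ copy j × pos i ≢ pos j) ⊎ (copy i ≢ copy j × pos i ≡ pos j)
  ; symm   = Sum.map (λ (p , q) → sym p , ≢-sym q) (λ (p , q) → ≢-sym p , sym q)
  ; irrefl = λ { refl (inj₁ (_ , q)) → q refl ; refl (inj₂ (p , _)) → p refl }
  ; adj?   = λ i j → ((copy i ≟ copy j) ×-dec ¬? (pos i ≟ pos j))
                     ⊎-dec (¬? (copy i ≟ copy j) ×-dec (pos i ≟ pos j))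
  }
  where
  copy : Fin (2 * a) → Fin 2
  copy = quotient a
  pos : Fin (2 * a) → Fin a
  pos = remainder {2} a

module _ (G H : Graph) where

  JoinAdj : Rel (Vertex G ⊎ Vertex H) 0ℓ
  JoinAdj (inj₁ x) (inj₁ y) = Adj G x y
  JoinAdj (inj₁ _) (inj₂ _) = ⊤
  JoinAdj (inj₂ _) (inj₁ _) = ⊤
  JoinAdj (inj₂ x) (inj₂ y) = Adj H x y

  joinSymm : Symmetric JoinAdj
  joinSymm {inj₁ _} {inj₁ _} e = symm G e
  joinSymm {inj₁ _} {inj₂ _} _ = tt
  joinSymm {inj₂ _} {inj₁ _} _ = tt
  joinSymm {inj₂ _} {inj₂ _} e = symm H e

  joinIrrefl : Irreflexive _≡_ JoinAdj
  joinIrrefl {inj₁ _} refl e = irrefl G refl e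
  joinIrrefl {inj₂ _} refl e = irrefl H refl e

  joinAdj? : Decidable JoinAdj
  joinAdj? (inj₁ x) (inj₁ y) = adj? G x y
  joinAdj? (inj₁ _) (inj₂ _) = yes tt
  joinAdj? (inj₂ _) (inj₁ _) = yes tt
  joinAdj? (inj₂ x) (inj₂ y) = adj? H x y

infixr 6 _∨_

_∨_ : Graph → Graph → Graph
G ∨ H = record
  { order  = order G + order H
  ; Adj    = λ i j → JoinAdj G H (split i) (split j)
  ; symm   = λ {i} {j} → joinSymm G H {split i} {split j}
  ; irrefl = λ { {i} refl → joinIrrefl G H {split i} refl }
  ; adj?   = λ i j → joinAdj? G H (split i) (split j)
  }
  where
  split : Fin (order G + order H) → Vertex G ⊎ Vertex H
  split = splitAt (order G)

⋁ : List Graph → Graph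
⋁ = foldr _∨_ ℰ

-- Meant for t ≤ ⌊ r /2⌋, where the subtraction does not truncate.
J : ℕ → ℕ → ℕ → Graph
J r a t = ⋁ (replicate t (H₀ a)) ∨ 𝒦 (r ∸ 2 * t) a

{-# OPTIONS --safe #-}

-- A set S fails to dominate iff it lies in some M v, the set of vertices outside N[ v ].  Hence
-- D(H) = D(𝒦 r a) forces, through the coefficients of xᵃ, xᵃ⁻¹ and x², that the M v are ra
-- distinct sets of size a − 1 and that at most ra(a − 1) ordered pairs of distinct vertices lie
-- in a common M v.  Every vertex x is in at least a − 1 such pairs, because two different sets
-- M v, M v′ of size a − 1 contain it; so it is in exactly a − 1.  Then lying in a common M v is
-- an equivalence relation with classes of size a, every M v is a class minus one vertex f v, and
-- symmetry of adjacency makes f an involution that permutes the classes.  A class fixed by f is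
-- independent and two exchanged classes induce H₀ a, so H ≅ J r a t.  Conversely, the dominating
-- sets of such a graph are those not properly contained in a class, independently of f.

module Submission where

open import Defs
open import Data.Nat.Base using (ℕ; zero; suc; _+_; _*_; _∸_; _≤_; _<_; _≥_; z≤n; s≤s; ⌊_/2⌋)
open import Data.Product.Base as Product using (_×_; _,_; ∃-syntax; Σ-syntax; proj₁; proj₂; map₂)
open import Function.Bundles using (_⇔_; mk⇔; _↔_; mk↔ₛ′; Inverse; Equivalence; Injection)
open import Relation.Unary using (_∈_)

import Data.Empty as Empty
open import Data.Fin.Base as Fin using (Fin; zero; suc; cast; join; combine; opposite)
open import Data.Fin.Permutation using (↔⇒≡)
import Data.Fin.Properties as Fin
open import Data.Fin.Properties using (_≟_; any?; ¬∀⟶∃¬)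
open import Data.Fin.Subset using (Subset; inside; outside; _⊆_; ∣_∣; ⁅_⁆; _∪_; ⊤; ⊥; ∁)
  renaming (_∈_ to _∈ˢ_; _∉_ to _∉ˢ_)
import Data.Fin.Subset.Properties as Sub
open import Data.List.Base using (List; []; _∷_; map; length; filter; applyUpTo; allFin; removeAt; lookup; replicate)
import Data.List.Membership.DecPropositional as DecMembership
open import Data.List.Membership.Propositional using () renaming (_∈_ to _∈ˡ_)
open import Data.List.Membership.Propositional.Properties
  using (∈-map⁺; ∈-map⁻; ∈-++⁺ˡ; ∈-++⁺ʳ; ∈-filter⁺; ∈-filter⁻; ∈-allFin; ∈-lookup; ∈-length)
import Data.List.Properties as List
open import Data.List.Relation.Unary.All as All using (All; []; _∷_)
open import Data.List.Relation.Unary.AllPairs using ([]; _∷_)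
open import Data.List.Relation.Unary.Any using (here; there; index)
open import Data.List.Relation.Unary.Any.Properties using (lookup-index)
open import Data.List.Relation.Unary.Unique.Propositional using (Unique)
import Data.List.Relation.Unary.Unique.Propositional.Properties as Unique
import Data.Nat.ListAction as List using (sum)
import Data.Nat.Properties as ℕ
open import Data.Product.Function.NonDependent.Propositional using (_×-↔_)
open import Data.Sum.Base as Sum using (_⊎_; inj₁; inj₂)
open import Data.Sum.Function.Propositional using (_⊎-↔_)
import Data.Vec.Base as Vec
import Data.Vec.Properties as Vec
open import Function.Base using (_∘_; id; case_of_)
open import Function.Construct.Composition using (_↔-∘_; _⇔-∘_)
open import Function.Construct.Identity using (↔-id)
open import Function.Construct.Symmetry using (↔-sym; ⇔-sym)
open import Function.Properties.Inverse using (↔⇒↣)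
open import Function.Related.TypeIsomorphisms using (×-distribʳ-⊎)
open import Relation.Binary.Core using (Rel)
open import Relation.Binary.Definitions using (tri<; tri≈; tri>)
open import Relation.Binary.PropositionalEquality hiding (J; [_])
open import Relation.Nullary.Decidable using (Dec; does; yes; no; ¬?; _×-dec_; _⊎-dec_; dec-true; decidable-stable)
open import Relation.Nullary.Negation using (¬_; contradiction)
import Relation.Unary as U
open import Algebra.Properties.CommutativeMonoid.Sum ℕ.+-0-commutativeMonoid
  using (sum; sum-cong-≗; ∑-distrib-+)

open Graph
open Equivalence using () renaming (to to ⇒; from to ⇐)

private variable
  A B B′ : Set
  n n′ : ℕ

-- Pigeonhole principle for lists

∈-removeAt : ∀ {x y : A} {ys} (x∈ys : x ∈ˡ ys) → y ∈ˡ ys → y ≡ x ⊎ y ∈ˡ removeAt ys (index x∈ys)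
∈-removeAt (here refl) (here refl)  = inj₁ refl
∈-removeAt (here refl) (there y∈ys) = inj₂ y∈ys
∈-removeAt (there x∈ys) (here refl) = inj₂ (here refl)
∈-removeAt (there x∈ys) (there y∈ys) with ∈-removeAt x∈ys y∈ys
... | inj₁ y≡x = inj₁ y≡x
... | inj₂ y∈  = inj₂ (there y∈)

-- Counting along relations rather than functions spares choosing images outside xs.
module _ (ρ : A → B → Set) where

  private
    Total : List A → List B → Set
    Total xs ys = ∀ {x} → x ∈ˡ xs → ∃[ y ] (y ∈ˡ ys × ρ x y)

    Inj : List A → Set
    Inj xs = ∀ {x x′ y} → x ∈ˡ xs → x′ ∈ˡ xs → ρ x y → ρ x′ y → x ≡ x′

    -- An element of `xs` that was matched to the removed `y` would equal `x` by injectivity,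
    -- against uniqueness of the list.
    shrink : ∀ {x y xs ys} → Unique (x ∷ xs) → Inj (x ∷ xs) → ρ x y →
             (y∈ys : y ∈ˡ ys) → Total (x ∷ xs) ys → Total xs (removeAt ys (index y∈ys))
    shrink uniq inj ρxy y∈ys total {z} z∈xs with total (there z∈xs)
    ... | y′ , y′∈ys , ρzy′ with ∈-removeAt y∈ys y′∈ys
    ...   | inj₂ y′∈ = y′ , y′∈ , ρzy′
    ...   | inj₁ refl with inj (here refl) (there z∈xs) ρxy ρzy′
    ...     | refl = contradiction z∈xs (Unique.Unique[x∷xs]⇒x∉xs uniq)

  pigeonhole-≤ : ∀ {xs ys} → Unique xs → Total xs ys → Inj xs → length xs ≤ length ys
  pigeonhole-≤ {[]} _ _ _ = z≤n
  pigeonhole-≤ {x ∷ xs} {ys} uniq@(_ ∷ uniq′) total inj with total (here refl)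
  ... | y , y∈ys , ρxy rewrite List.length-removeAt′ ys (index y∈ys) =
    s≤s (pigeonhole-≤ uniq′ (shrink uniq inj ρxy y∈ys total)
                      (λ p q → inj (there p) (there q)))

  -- Equality case of the count: as `ys` is no longer than `xs`, the induction cannot run out of
  -- `xs` while some `y` remains unmatched.
  pigeonhole-onto : ∀ {xs ys} → Unique xs → Total xs ys → Inj xs → length ys ≤ length xs →
                    ∀ {y} → y ∈ˡ ys → ∃[ x ] (x ∈ˡ xs × ρ x y)
  pigeonhole-onto {[]} {_ ∷ _} _ _ _ () _
  pigeonhole-onto {x ∷ xs} {ys} uniq@(_ ∷ uniq′) total inj ys≤xs y∈ys with total (here refl)
  ... | y′ , y′∈ys , ρxy′ with ∈-removeAt y′∈ys y∈ys
  ...   | inj₁ refl = x , here refl , ρxy′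
  ...   | inj₂ y∈ with
      pigeonhole-onto uniq′ (shrink uniq inj ρxy′ y′∈ys total) (λ p q → inj (there p) (there q))
        (ℕ.≤-pred (subst (_≤ _) (List.length-removeAt′ ys (index y′∈ys)) ys≤xs)) y∈
  ...     | z , z∈xs , ρzy = z , there z∈xs , ρzy

-- Subsets of `Fin n`, their elements and their cardinalities

elements : Subset n → List (Fin n)
elements Vec.[] = []
elements (inside  Vec.∷ S) = zero ∷ map suc (elements S)
elements (outside Vec.∷ S) = map suc (elements S)

length-elements : (S : Subset n) → length (elements S) ≡ ∣ S ∣
length-elements Vec.[] = refl
length-elements (inside  Vec.∷ S) = cong suc (trans (List.length-map suc (elements S)) (length-elements S))
length-elements (outside Vec.∷ S) = trans (List.length-map suc (elements S)) (length-elements S)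

∈-elements⁺ : {S : Subset n} {x : Fin n} → x ∈ˢ S → x ∈ˡ elements S
∈-elements⁺ Vec.here = here refl
∈-elements⁺ {S = inside  Vec.∷ _} (Vec.there x∈S) = there (∈-map⁺ suc (∈-elements⁺ x∈S))
∈-elements⁺ {S = outside Vec.∷ _} (Vec.there x∈S) = ∈-map⁺ suc (∈-elements⁺ x∈S)

∈-elements⁻ : (S : Subset n) {x : Fin n} → x ∈ˡ elements S → x ∈ˢ S
∈-elements⁻ (inside Vec.∷ S) (here refl) = Vec.here
∈-elements⁻ (inside Vec.∷ S) (there x∈) with ∈-map⁻ suc x∈
... | _ , y∈ , refl = Vec.there (∈-elements⁻ S y∈)
∈-elements⁻ (outside Vec.∷ S) x∈ with ∈-map⁻ suc x∈
... | _ , y∈ , refl = Vec.there (∈-elements⁻ S y∈)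

elements-unique : (S : Subset n) → Unique (elements S)
elements-unique Vec.[] = []
elements-unique (inside Vec.∷ S) =
  All.tabulate (λ x∈ → λ { refl → zero∉ (∈-map⁻ suc x∈) })
  ∷ Unique.map⁺ Fin.suc-injective (elements-unique S)
  where
  zero∉ : ¬ (∃[ y ] (y ∈ˡ elements S × zero ≡ suc y))
  zero∉ (_ , _ , ())
elements-unique (outside Vec.∷ S) = Unique.map⁺ Fin.suc-injective (elements-unique S)

module _ (ρ : Fin n → Fin n′ → Set) {S : Subset n} {T : Subset n′}
         (total : ∀ {x} → x ∈ˢ S → ∃[ y ] (y ∈ˢ T × ρ x y))
         (inj : ∀ {x x′ y} → x ∈ˢ S → x′ ∈ˢ S → ρ x y → ρ x′ y → x ≡ x′) where

  private
    total′ : ∀ {x} → x ∈ˡ elements S → ∃[ y ] (y ∈ˡ elements T × ρ x y)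
    total′ x∈ with total (∈-elements⁻ S x∈)
    ... | y , y∈T , ρxy = y , ∈-elements⁺ y∈T , ρxy

    inj′ : ∀ {x x′ y} → x ∈ˡ elements S → x′ ∈ˡ elements S → ρ x y → ρ x′ y → x ≡ x′
    inj′ p q = inj (∈-elements⁻ S p) (∈-elements⁻ S q)

  card-≤ : ∣ S ∣ ≤ ∣ T ∣
  card-≤ = subst₂ _≤_ (length-elements S) (length-elements T)
    (pigeonhole-≤ ρ (elements-unique S) total′ inj′)

  card-onto : ∣ T ∣ ≤ ∣ S ∣ → ∀ {y} → y ∈ˢ T → ∃[ x ] (x ∈ˢ S × ρ x y)
  card-onto T≤S y∈T with
    pigeonhole-onto ρ (elements-unique S) total′ inj′
      (subst₂ _≤_ (sym (length-elements T)) (sym (length-elements S)) T≤S) (∈-elements⁺ y∈T)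
  ... | x , x∈ , ρxy = x , ∈-elements⁻ S x∈ , ρxy

⊆∧card≥⇒⊇ : {S T : Subset n} → S ⊆ T → ∣ T ∣ ≤ ∣ S ∣ → T ⊆ S
⊆∧card≥⇒⊇ {S = S} {T} S⊆T T≤S y∈T with
  card-onto _≡_ {S} {T} (λ {x} x∈S → x , S⊆T x∈S , refl) (λ _ _ p q → trans p (sym q)) T≤S y∈T
... | _ , x∈S , refl = x∈S

⊆∧card≥⇒≡ : {S T : Subset n} → S ⊆ T → ∣ T ∣ ≤ ∣ S ∣ → S ≡ T
⊆∧card≥⇒≡ S⊆T T≤S = Sub.⊆-antisym S⊆T (⊆∧card≥⇒⊇ S⊆T T≤S)

⟪_⟫ : {P : Fin n → Set} → U.Decidable P → Subset n
⟪ P? ⟫ = Vec.tabulate (does ∘ P?)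

module _ {P : Fin n → Set} (P? : U.Decidable P) where

  ∈⟪⟫⁺ : ∀ {x} → P x → x ∈ˢ ⟪ P? ⟫
  ∈⟪⟫⁺ {x} px = Vec.lookup⇒[]= x _ (trans (Vec.lookup∘tabulate (does ∘ P?) x) (dec-true (P? x) px))

  ∈⟪⟫⁻ : ∀ {x} → x ∈ˢ ⟪ P? ⟫ → P x
  ∈⟪⟫⁻ {x} x∈ with P? x | trans (sym (Vec.lookup∘tabulate (does ∘ P?) x)) (Vec.[]=⇒lookup x∈)
  ... | yes px | _ = px

∣pair∣ : {x y : Fin n} → y ≢ x → ∣ ⁅ x ⁆ ∪ ⁅ y ⁆ ∣ ≡ 2
∣pair∣ {x = x} {y} y≢x = ℕ.≤-antisym
  (subst (_≤ 2) (length-elements (⁅ x ⁆ ∪ ⁅ y ⁆))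
    (pigeonhole-≤ _≡_ {ys = x ∷ y ∷ []} (elements-unique (⁅ x ⁆ ∪ ⁅ y ⁆))
      (λ z∈ → _ , split (∈-elements⁻ (⁅ x ⁆ ∪ ⁅ y ⁆) z∈) , refl) (λ _ _ p q → trans p (sym q))))
  (subst (2 ≤_) (length-elements (⁅ x ⁆ ∪ ⁅ y ⁆))
    (pigeonhole-≤ _≡_ {xs = x ∷ y ∷ []} ((≢-sym y≢x ∷ []) ∷ [] ∷ [])
      (λ z∈ → _ , ∈-elements⁺ (merge z∈) , refl) (λ _ _ p q → trans p (sym q))))
  where
  split : ∀ {z} → z ∈ˢ ⁅ x ⁆ ∪ ⁅ y ⁆ → z ∈ˡ x ∷ y ∷ []
  split z∈ with Sub.x∈p∪q⁻ ⁅ x ⁆ ⁅ y ⁆ z∈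
  ... | inj₁ z∈x = here (Sub.x∈⁅y⁆⇒x≡y x z∈x)
  ... | inj₂ z∈y = there (here (Sub.x∈⁅y⁆⇒x≡y y z∈y))

  merge : ∀ {z} → z ∈ˡ x ∷ y ∷ [] → z ∈ˢ ⁅ x ⁆ ∪ ⁅ y ⁆
  merge (here refl) = Sub.x∈p∪q⁺ (inj₁ (Sub.x∈⁅x⁆ x))
  merge (there (here refl)) = Sub.x∈p∪q⁺ (inj₂ (Sub.x∈⁅x⁆ y))

-- Finite sums, enumeration of subsets, double counting

sum-mono : ∀ {n} {f g : Fin n → ℕ} → (∀ x → f x ≤ g x) → sum f ≤ sum g
sum-mono {zero}  f≤g = z≤n
sum-mono {suc n} f≤g = ℕ.+-mono-≤ (f≤g zero) (sum-mono (f≤g ∘ suc))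

sum-≤ : ∀ {n k} {f : Fin n → ℕ} → (∀ x → f x ≤ k) → sum f ≤ n * k
sum-≤ {zero}  f≤k = z≤n
sum-≤ {suc n} f≤k = ℕ.+-mono-≤ (f≤k zero) (sum-≤ (f≤k ∘ suc))

sum-≥ : ∀ {n k} {f : Fin n → ℕ} → (∀ x → k ≤ f x) → n * k ≤ sum f
sum-≥ {zero}  k≤f = z≤n
sum-≥ {suc n} k≤f = ℕ.+-mono-≤ (k≤f zero) (sum-≥ (k≤f ∘ suc))

-- The other terms already contribute at least `k` each, which leaves at most `k` for `f x`. This
-- turns a bound on the total number of pairs into a bound at every vertex.
sum-squeeze : ∀ {n k} {f : Fin n → ℕ} → (∀ x → k ≤ f x) → sum f ≤ n * k → ∀ x → f x ≤ k
sum-squeeze {suc n} {k} {f} k≤f Σ≤ zero = ℕ.+-cancelʳ-≤ (n * k) (f zero) k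
  (ℕ.≤-trans (ℕ.+-monoʳ-≤ (f zero) (sum-≥ (k≤f ∘ suc))) Σ≤)
sum-squeeze {suc n} {k} {f} k≤f Σ≤ (suc x) = sum-squeeze (k≤f ∘ suc)
  (ℕ.+-cancelˡ-≤ k (sum (f ∘ suc)) (n * k) (ℕ.≤-trans (ℕ.+-monoˡ-≤ _ (k≤f zero)) Σ≤)) x

length-filter-split : {P Q : A → Set} (P? : U.Decidable P) (Q? : U.Decidable Q) (xs : List A) →
  length (filter Q? xs) ≡
  length (filter (λ x → P? x ×-dec Q? x) xs) + length (filter (λ x → ¬? (P? x) ×-dec Q? x) xs)
length-filter-split P? Q? [] = refl
length-filter-split P? Q? (x ∷ xs) with P? x | Q? x
... | yes _ | yes _ = cong suc (length-filter-split P? Q? xs)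
... | yes _ | no  _ = length-filter-split P? Q? xs
... | no  _ | yes _ = trans (cong suc (length-filter-split P? Q? xs)) (sym (ℕ.+-suc _ _))
... | no  _ | no  _ = length-filter-split P? Q? xs

∈-subsets : (S : Subset n) → S ∈ˡ subsets n
∈-subsets Vec.[] = here refl
∈-subsets (inside  Vec.∷ S) = ∈-++⁺ˡ (∈-map⁺ _ (∈-subsets S))
∈-subsets (outside Vec.∷ S) = ∈-++⁺ʳ _ (∈-map⁺ _ (∈-subsets S))

subsets-unique : ∀ n → Unique (subsets n)
subsets-unique zero    = [] ∷ []
subsets-unique (suc n) = Unique.++⁺
  (Unique.map⁺ Vec.∷-injectiveʳ (subsets-unique n))
  (Unique.map⁺ Vec.∷-injectiveʳ (subsets-unique n))
  λ (p , q) → disjoint (∈-map⁻ _ p) (∈-map⁻ _ q)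
  where
  disjoint : ∀ {S} → ∃[ T ] (T ∈ˡ subsets n × S ≡ inside Vec.∷ T) →
             ¬ (∃[ T ] (T ∈ˡ subsets n × S ≡ outside Vec.∷ T))
  disjoint (_ , _ , refl) (_ , _ , ())

subset-of-card : (S : Subset n) {i : ℕ} → i ≤ ∣ S ∣ → ∃[ T ] (T ⊆ S × ∣ T ∣ ≡ i)
subset-of-card {n} S {zero} _ = ⊥ , Sub.⊥⊆ , Sub.∣⊥∣≡0 n
subset-of-card (inside Vec.∷ S) {suc i} (s≤s i≤S) with subset-of-card S i≤S
... | T , T⊆S , refl = inside Vec.∷ T , Sub.s⊆s T⊆S , refl
subset-of-card (outside Vec.∷ S) {suc i} i≤S with subset-of-card S i≤S
... | T , T⊆S , ∣T∣≡i = outside Vec.∷ T , Sub.s⊆s T⊆S , ∣T∣≡i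

-- The indicator of `x ∈ S` is written as the length of a filtered singleton, so that `double-count`
-- can merge it with the filtered tail by `filter-++`.
∣S∣-incidence : (S : Subset n) → ∣ S ∣ ≡ sum (λ x → length (filter (x Sub.∈?_) (S ∷ [])))
∣S∣-incidence Vec.[] = refl
∣S∣-incidence {suc n} (s Vec.∷ S) with trans (∣S∣-incidence S) (sum-cong-≗ {n} shift)
  where
  shift : ∀ x → length (filter (x Sub.∈?_) (S ∷ [])) ≡ length (filter (suc x Sub.∈?_) ((s Vec.∷ S) ∷ []))
  shift x with x Sub.∈? S
  ... | yes _ = refl
  ... | no  _ = refl
∣S∣-incidence (inside  Vec.∷ S) | eq = cong suc eq
∣S∣-incidence (outside Vec.∷ S) | eq = eq

double-count : (L : List (Subset n)) →
  List.sum (map ∣_∣ L) ≡ sum (λ x → length (filter (x Sub.∈?_) L))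
double-count {n} [] = ℕ.≤-antisym z≤n
  (subst (sum {n} (λ _ → 0) ≤_) (ℕ.*-zeroʳ n) (sum-≤ {n} {f = λ _ → 0} λ _ → z≤n))
double-count {n} (S ∷ L) = begin
  ∣ S ∣ + List.sum (map ∣_∣ L)
    ≡⟨ cong₂ _+_ (∣S∣-incidence S) (double-count L) ⟩
  sum (λ x → length (filter (x Sub.∈?_) (S ∷ []))) + sum (λ x → length (filter (x Sub.∈?_) L))
    ≡⟨ ∑-distrib-+ {n} _ _ ⟨
  sum (λ x → length (filter (x Sub.∈?_) (S ∷ [])) + length (filter (x Sub.∈?_) L))
    ≡⟨ sum-cong-≗ {n} (λ x → trans (cong length (List.filter-++ (x Sub.∈?_) (S ∷ []) L))
         (List.length-++ (filter (x Sub.∈?_) (S ∷ [])))) ⟨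
  sum (λ x → length (filter (x Sub.∈?_) (S ∷ L))) ∎
  where open ≡-Reasoning

sum-map-constant : ∀ {f : A → ℕ} {k xs} → All (λ x → f x ≡ k) xs → List.sum (map f xs) ≡ length xs * k
sum-map-constant [] = refl
sum-map-constant (refl ∷ ps) = cong (_ +_) (sum-map-constant ps)

-- Non-neighbourhoods, non-dominating sets and non-dominating pairs

module _ (G : Graph) where

  -- The vertices outside N[ v ]; a set is non-dominating iff it lies in one of these.
  M : Vertex G → Subset (order G)
  M v = ⟪ (λ x → ¬? ((v ≟ x) ⊎-dec adj? G x v)) ⟫

  module _ {v x : Vertex G} where

    ∈M⁺ : ¬ N[_] G x v → x ∈ˢ M v
    ∈M⁺ = ∈⟪⟫⁺ (λ x → ¬? ((v ≟ x) ⊎-dec adj? G x v))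

    ∈M⁻ : x ∈ˢ M v → ¬ N[_] G x v
    ∈M⁻ = ∈⟪⟫⁻ (λ x → ¬? ((v ≟ x) ⊎-dec adj? G x v))

  M-sym : ∀ {v x} → x ∈ˢ M v → v ∈ˢ M x
  M-sym x∈Mv = ∈M⁺ λ { (inj₁ x≡v) → ∈M⁻ x∈Mv (inj₁ (sym x≡v))
                     ; (inj₂ vx)  → ∈M⁻ x∈Mv (inj₂ (symm G vx)) }

  M-irrefl : ∀ {v} → v ∉ˢ M v
  M-irrefl v∈Mv = ∈M⁻ v∈Mv (inj₁ refl)

  ⊆M⇒¬Dominating : ∀ {S v} → S ⊆ M v → ¬ Dominating G S
  ⊆M⇒¬Dominating {v = v} S⊆M dom with dom v
  ... | _ , x∈S , xv = ∈M⁻ (S⊆M x∈S) xv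

  ¬Dominating⇒⊆M : ∀ {S} → ¬ Dominating G S → ∃[ v ] (S ⊆ M v)
  ¬Dominating⇒⊆M {S} ¬dom with
    ¬∀⟶∃¬ (order G) _ (λ v → any? λ x → (x Sub.∈? S) ×-dec ((v ≟ x) ⊎-dec adj? G x v)) ¬dom
  ... | v , ¬∃ = v , λ {x} x∈S → ∈M⁺ λ xv → ¬∃ (x , x∈S , xv)

  nonDominating : ℕ → List (Subset (order G))
  nonDominating i = filter (λ S → ¬? (dominating? G S) ×-dec (∣ S ∣ ℕ.≟ i)) (subsets (order G))

  nonDominating-unique : ∀ i → Unique (nonDominating i)
  nonDominating-unique i = Unique.filter⁺ _ (subsets-unique (order G))

  ∈-nonDominating⁺ : ∀ {S v} → S ⊆ M v → S ∈ˡ nonDominating ∣ S ∣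
  ∈-nonDominating⁺ {S} S⊆M = ∈-filter⁺ _ (∈-subsets S) (⊆M⇒¬Dominating S⊆M , refl)

  ∈-nonDominating⁻ : ∀ {i S} → S ∈ˡ nonDominating i → (∃[ v ] (S ⊆ M v)) × ∣ S ∣ ≡ i
  ∈-nonDominating⁻ {i} S∈ with
    ∈-filter⁻ (λ S → ¬? (dominating? G S) ×-dec (∣ S ∣ ℕ.≟ i)) {xs = subsets (order G)} S∈
  ... | _ , ¬dom , ∣S∣≡i = ¬Dominating⇒⊆M ¬dom , ∣S∣≡i

  -- The left side depends on the order of `G` alone, so graphs of equal order with the same `d`
  -- have equally many non-dominating sets of each size.
  d+nonDominating : ∀ i → length (filter (λ S → ∣ S ∣ ℕ.≟ i) (subsets (order G)))
                          ≡ d G i + length (nonDominating i)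
  d+nonDominating i = length-filter-split (dominating? G) (λ S → ∣ S ∣ ℕ.≟ i) (subsets (order G))

  pairs-at : Vertex G → List (Subset (order G))
  pairs-at x = filter (x Sub.∈?_) (nonDominating 2)

  -- Each non-dominating pair is counted once at each of its two elements.
  sum-pairs-at : length (nonDominating 2) * 2 ≡ sum (length ∘ pairs-at)
  sum-pairs-at = trans
    (sym (sum-map-constant (All.tabulate λ S∈ → proj₂ (∈-nonDominating⁻ S∈))))
    (double-count (nonDominating 2))

  common? : ∀ x → U.Decidable (λ y → y ≢ x × ∃[ v ] (x ∈ˢ M v × y ∈ˢ M v))
  common? x y = ¬? (y ≟ x) ×-dec any? λ v → (x Sub.∈? M v) ×-dec (y Sub.∈? M v)

  -- These are the vertices `y ≢ x` that form a non-dominating pair with `x`.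
  C : Vertex G → Subset (order G)
  C x = ⟪ common? x ⟫

  ∣C∣≤pairs-at : ∀ x → ∣ C x ∣ ≤ length (pairs-at x)
  ∣C∣≤pairs-at x = subst (_≤ length (pairs-at x)) (length-elements (C x))
    (pigeonhole-≤ (λ y S → S ≡ ⁅ x ⁆ ∪ ⁅ y ⁆) (elements-unique (C x)) total inj)
    where
    pair⊆ : ∀ {y v} → x ∈ˢ M v → y ∈ˢ M v → ⁅ x ⁆ ∪ ⁅ y ⁆ ⊆ M v
    pair⊆ {y} x∈ y∈ z∈ with Sub.x∈p∪q⁻ ⁅ x ⁆ ⁅ y ⁆ z∈
    ... | inj₁ z∈x rewrite Sub.x∈⁅y⁆⇒x≡y x z∈x = x∈
    ... | inj₂ z∈y rewrite Sub.x∈⁅y⁆⇒x≡y y z∈y = y∈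

    total : ∀ {y} → y ∈ˡ elements (C x) → ∃[ S ] (S ∈ˡ pairs-at x × S ≡ ⁅ x ⁆ ∪ ⁅ y ⁆)
    total {y} y∈ with ∈⟪⟫⁻ (common? x) (∈-elements⁻ (C x) y∈)
    ... | y≢x , v , x∈Mv , y∈Mv = _ ,
      ∈-filter⁺ (x Sub.∈?_)
        (subst (λ i → ⁅ x ⁆ ∪ ⁅ y ⁆ ∈ˡ nonDominating i) (∣pair∣ y≢x) (∈-nonDominating⁺ (pair⊆ x∈Mv y∈Mv)))
        (Sub.x∈p∪q⁺ (inj₁ (Sub.x∈⁅x⁆ x)))
      , refl

    inj : ∀ {y y′ S} → y ∈ˡ elements (C x) → y′ ∈ˡ elements (C x) →
          S ≡ ⁅ x ⁆ ∪ ⁅ y ⁆ → S ≡ ⁅ x ⁆ ∪ ⁅ y′ ⁆ → y ≡ y′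
    inj {y} {y′} y∈ _ refl eq with
      Sub.x∈p∪q⁻ ⁅ x ⁆ ⁅ y′ ⁆ (subst (y ∈ˢ_) eq (Sub.x∈p∪q⁺ (inj₂ (Sub.x∈⁅x⁆ y))))
    ... | inj₁ y∈x  = contradiction (Sub.x∈⁅y⁆⇒x≡y x y∈x)
                        (proj₁ (∈⟪⟫⁻ (common? x) (∈-elements⁻ (C x) y∈)))
    ... | inj₂ y∈y′ = Sub.x∈⁅y⁆⇒x≡y y′ y∈y′

  -- A pair at `x` is determined by its other element, which lies in `C x`. The superset `T` is left
  -- free so that it can be `M x`, whose size is known, when the bound is applied to `𝒦`.
  pairs-at≤ : ∀ x {T} → C x ⊆ T → length (pairs-at x) ≤ ∣ T ∣
  pairs-at≤ x {T} C⊆T = subst (length (pairs-at x) ≤_) (length-elements T)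
    (pigeonhole-≤ (λ S y → y ∈ˢ S × y ≢ x) (Unique.filter⁺ _ (nonDominating-unique 2)) total inj)
    where
    ∈-pairs-at⁻ : ∀ {S} → S ∈ˡ pairs-at x → x ∈ˢ S × (∃[ v ] (S ⊆ M v)) × ∣ S ∣ ≡ 2
    ∈-pairs-at⁻ S∈ with ∈-filter⁻ (x Sub.∈?_) {xs = nonDominating 2} S∈
    ... | S∈ND , x∈S = x∈S , ∈-nonDominating⁻ S∈ND

    is-pair : ∀ {S y} → S ∈ˡ pairs-at x → y ∈ˢ S → y ≢ x → ⁅ x ⁆ ∪ ⁅ y ⁆ ≡ S
    is-pair {S} {y} S∈ y∈S y≢x with ∈-pairs-at⁻ S∈
    ... | x∈S , _ , ∣S∣≡2 =
      ⊆∧card≥⇒≡ sub (subst₂ _≤_ (sym ∣S∣≡2) (sym (∣pair∣ y≢x)) ℕ.≤-refl)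
      where
      sub : ⁅ x ⁆ ∪ ⁅ y ⁆ ⊆ S
      sub z∈ with Sub.x∈p∪q⁻ ⁅ x ⁆ ⁅ y ⁆ z∈
      ... | inj₁ z∈x rewrite Sub.x∈⁅y⁆⇒x≡y x z∈x = x∈S
      ... | inj₂ z∈y rewrite Sub.x∈⁅y⁆⇒x≡y y z∈y = y∈S

    total : ∀ {S} → S ∈ˡ pairs-at x → ∃[ y ] (y ∈ˡ elements T × (y ∈ˢ S × y ≢ x))
    total {S} S∈ with ∈-pairs-at⁻ S∈ | any? (λ y → (y Sub.∈? S) ×-dec ¬? (y ≟ x))
    ... | x∈S , (v , S⊆M) , _ | yes (y , y∈S , y≢x) =
      y , ∈-elements⁺ (C⊆T (∈⟪⟫⁺ (common? x) (y≢x , v , S⊆M x∈S , S⊆M y∈S))) , y∈S , y≢x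
    ... | x∈S , _ , ∣S∣≡2 | no none =
      contradiction (Sub.p⊆q⇒∣p∣≤∣q∣ S⊆x)
        (subst₂ (λ i j → ¬ (i ≤ j)) (sym ∣S∣≡2) (sym (Sub.∣⁅x⁆∣≡1 x)) λ { (s≤s ()) })
      where
      S⊆x : S ⊆ ⁅ x ⁆
      S⊆x {z} z∈S with z ≟ x
      ... | yes refl = Sub.x∈⁅x⁆ x
      ... | no  z≢x  = contradiction (z , z∈S , z≢x) none

    inj : ∀ {S S′ y} → S ∈ˡ pairs-at x → S′ ∈ˡ pairs-at x →
          y ∈ˢ S × y ≢ x → y ∈ˢ S′ × y ≢ x → S ≡ S′
    inj S∈ S′∈ (y∈S , y≢x) (y∈S′ , _) = trans (sym (is-pair S∈ y∈S y≢x)) (is-pair S′∈ y∈S′ y≢x)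

-- Choosing elements of finite sets

infix 4 _∈ˡ?_

_∈ˡ?_ : (x : Fin n) (xs : List (Fin n)) → Dec (x ∈ˡ xs)
_∈ˡ?_ = DecMembership._∈?_ _≟_

avoid : (S : Subset n) (L : List (Fin n)) → length L < ∣ S ∣ → ∃[ y ] (y ∈ˢ S × ¬ y ∈ˡ L)
avoid {n} S L L<S with any? (λ y → (y Sub.∈? S) ×-dec ¬? (y ∈ˡ? L))
... | yes found = found
... | no  none  = contradiction
  (subst (_≤ length L) (length-elements S)
    (pigeonhole-≤ _≡_ (elements-unique S)
      (λ {x} x∈ → x , decidable-stable (x ∈ˡ? L) (λ x∉L → none (x , ∈-elements⁻ S x∈ , x∉L)) , refl)
      (λ _ _ p q → trans p (sym q))))
  (ℕ.<⇒≱ L<S)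

least : {P : Fin n → Set} → U.Decidable P → ∃[ i ] P i → ∃[ i ] (P i × (∀ {j} → P j → i Fin.≤ j))
least {suc n} P? ∃P with P? zero
... | yes p₀ = zero , p₀ , λ _ → z≤n
least {suc n} P? (zero  , p) | no ¬p₀ = contradiction p ¬p₀
least {suc n} {P} P? (suc i , p) | no ¬p₀ with least (P? ∘ suc) (i , p)
... | i′ , p′ , i′≤ = suc i′ , p′ , bound
  where
  bound : ∀ {j} → P j → suc i′ Fin.≤ j
  bound {zero}  p₀ = contradiction p₀ ¬p₀
  bound {suc j} pⱼ = s≤s (i′≤ pⱼ)

lookup-injective : {xs : List A} → Unique xs → ∀ {i j} → lookup xs i ≡ lookup xs j → i ≡ j
lookup-injective (_ ∷ _)  {zero}  {zero}  _  = refl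
lookup-injective (x∉ ∷ _) {zero}  {suc j} eq = contradiction eq (All.lookup x∉ (∈-lookup j))
lookup-injective (x∉ ∷ _) {suc i} {zero}  eq = contradiction (sym eq) (All.lookup x∉ (∈-lookup i))
lookup-injective (_ ∷ uniq) {suc i} {suc j} eq = cong suc (lookup-injective uniq eq)

⊈⇒∃ : (S T : Subset n) → ¬ S ⊆ T → ∃[ x ] (x ∈ˢ S × x ∉ˢ T)
⊈⇒∃ S T S⊈T with any? (λ x → (x Sub.∈? S) ×-dec ¬? (x Sub.∈? T))
... | yes found = found
... | no  none  = contradiction
  (λ {x} x∈S → decidable-stable (x Sub.∈? T) (λ x∉T → none (x , x∈S , x∉T))) S⊈T

-- Sizes of `M` and `C` forced by the numbers of non-dominating sets

module _ (G : Graph) where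

  -- A larger `M G v` would contain a set of size `suc k`, and every subset of `M G v` is
  -- non-dominating.
  ∣M∣≤ : ∀ {k} → length (nonDominating G (suc k)) ≡ 0 → ∀ v → ∣ M G v ∣ ≤ k
  ∣M∣≤ {k} nd≡0 v = ℕ.≮⇒≥ λ k<M → bad (subset-of-card (M G v) k<M)
    where
    bad : ¬ (∃[ T ] (T ⊆ M G v × ∣ T ∣ ≡ suc k))
    bad (T , T⊆M , ∣T∣≡) = contradiction
      (subst (0 <_) nd≡0 (∈-length (subst (λ i → T ∈ˡ nonDominating G i) ∣T∣≡ (∈-nonDominating⁺ G T⊆M))))
      λ ()

  module _ {k} (∣M∣≤k : ∀ v → ∣ M G v ∣ ≤ k) (n≤nd : order G ≤ length (nonDominating G k)) where

    private
      choose : ∀ {S} → S ∈ˡ nonDominating G k → ∃[ v ] S ≡ M G v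
      choose S∈ with ∈-nonDominating⁻ G S∈
      ... | (v , S⊆M) , refl = v , ⊆∧card≥⇒≡ S⊆M (∣M∣≤k v)

    -- A non-dominating `k`-set lies in some `M G v` of size at most `k`, hence equals it. These
    -- sets are at least as many as the vertices, so matching each of them with such a `v` reaches
    -- every vertex.
    ∣M∣≡ : ∀ v → ∣ M G v ∣ ≡ k
    ∣M∣≡ v with pigeonhole-onto (λ S v → S ≡ M G v) (nonDominating-unique G k)
                  (λ S∈ → map₂ (λ eq → ∈-allFin _ , eq) (choose S∈))
                  (λ _ _ p q → trans p (sym q))
                  (subst (_≤ length (nonDominating G k)) (sym (List.length-tabulate {n = order G} id)) n≤nd)
                  (∈-allFin v)
    ... | S , S∈ , refl = proj₂ (∈-nonDominating⁻ G S∈)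

    -- If distinct `v` and `w` had the same set, the vertices other than `w` would still account for
    -- all non-dominating `k`-sets, and they are too few.
    M-injective : ∀ {v w} → M G v ≡ M G w → v ≡ w
    M-injective {v} {w} Mv≡Mw = decidable-stable (v ≟ w) λ v≢w →
      ℕ.<⇒≱ (subst (_≤ length (nonDominating G k)) n≡ n≤nd)
        (pigeonhole-≤ (λ S u → S ≡ M G u) (nonDominating-unique G k)
          (total v≢w) (λ _ _ p q → trans p (sym q)))
      where
      others : List (Vertex G)
      others = removeAt (allFin (order G)) (index (∈-allFin w))

      n≡ : order G ≡ suc (length others)
      n≡ = trans (sym (List.length-tabulate {n = order G} id))
                 (List.length-removeAt′ (allFin (order G)) (index (∈-allFin w)))

      total : v ≢ w → ∀ {S} → S ∈ˡ nonDominating G k → ∃[ u ] (u ∈ˡ others × S ≡ M G u)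
      total v≢w S∈ with choose S∈
      ... | u , S≡Mu with ∈-removeAt (∈-allFin w) (∈-allFin u)
      ...   | inj₂ u∈ = u , u∈ , S≡Mu
      ...   | inj₁ refl with ∈-removeAt (∈-allFin w) (∈-allFin v)
      ...     | inj₁ v≡w = contradiction v≡w v≢w
      ...     | inj₂ v∈  = v , v∈ , trans S≡Mu (sym Mv≡Mw)

module _ (G : Graph) {k : ℕ} (∣M∣≡k : ∀ v → ∣ M G v ∣ ≡ k)
         (M-inj : ∀ {v w} → M G v ≡ M G w → v ≡ w) where

  -- For distinct `v` and `v′` in `M G x`, the set `M G v` contains `x` and contributes its other
  -- `k ∸ 1` elements to `C G x`. Some `z` in `M G v′` outside `M G v` supplies one more: the
  -- injection sends `x` to `z` and fixes the rest.
  ∣C∣≥ : 2 ≤ k → ∀ x → k ≤ ∣ C G x ∣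
  ∣C∣≥ 2≤k x with avoid (M G x) [] (subst (0 <_) (sym (∣M∣≡k x)) (ℕ.<-trans (s≤s z≤n) 2≤k))
  ... | v , v∈Mx , _ with avoid (M G x) (v ∷ []) (subst (1 <_) (sym (∣M∣≡k x)) 2≤k)
  ...   | v′ , v′∈Mx , v′∉[v] with ⊈⇒∃ (M G v′) (M G v) Mv′⊈Mv
    where
    Mv′⊈Mv : ¬ (M G v′ ⊆ M G v)
    Mv′⊈Mv sub = v′∉[v] (here (M-inj
      (⊆∧card≥⇒≡ sub (ℕ.≤-reflexive (trans (∣M∣≡k v) (sym (∣M∣≡k v′)))))))
  ...     | z , z∈Mv′ , z∉Mv = subst (_≤ ∣ C G x ∣) (∣M∣≡k v)
    (card-≤ (λ y y′ → (y ≡ x × y′ ≡ z) ⊎ (y ≢ x × y′ ≡ y)) {M G v} {C G x} total inj)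
    where
    total : ∀ {y} → y ∈ˢ M G v → ∃[ y′ ] (y′ ∈ˢ C G x × ((y ≡ x × y′ ≡ z) ⊎ (y ≢ x × y′ ≡ y)))
    total {y} y∈Mv with y ≟ x
    ... | yes refl = z
                   , ∈⟪⟫⁺ (common? G x) ((λ { refl → z∉Mv y∈Mv }) , v′ , M-sym G v′∈Mx , z∈Mv′)
                   , inj₁ (refl , refl)
    ... | no  y≢x  = y , ∈⟪⟫⁺ (common? G x) (y≢x , v , M-sym G v∈Mx , y∈Mv) , inj₂ (y≢x , refl)

    inj : ∀ {y y′ w} → y ∈ˢ M G v → y′ ∈ˢ M G v → (y ≡ x × w ≡ z) ⊎ (y ≢ x × w ≡ y) →
          (y′ ≡ x × w ≡ z) ⊎ (y′ ≢ x × w ≡ y′) → y ≡ y′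
    inj _ _ (inj₁ (refl , _)) (inj₁ (refl , _)) = refl
    inj _ y′∈ (inj₁ (_ , refl)) (inj₂ (_ , refl)) = contradiction y′∈ z∉Mv
    inj y∈ _ (inj₂ (_ , refl)) (inj₁ (_ , refl)) = contradiction y∈ z∉Mv
    inj _ _ (inj₂ (_ , refl)) (inj₂ (_ , refl)) = refl

  ∣C∣≤ : 2 ≤ k → length (nonDominating G 2) * 2 ≤ order G * k → ∀ x → ∣ C G x ∣ ≤ k
  ∣C∣≤ 2≤k nd₂≤ = sum-squeeze (∣C∣≥ 2≤k) (ℕ.≤-trans (sum-mono (∣C∣≤pairs-at G))
    (subst (_≤ order G * k) (sum-pairs-at G) nd₂≤))

-- Block structure of the non-neighbourhoods

swap : A × Fin 2 ⊎ B → A × Fin 2 ⊎ B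
swap = Sum.map (Product.map₂ Fin.opposite) id

-- With k = a − 1, the relation _~_ below partitions the vertices into blocks of size a, and
-- every M v is a block with the single vertex f v removed.
module Blocks {n k : ℕ} (3≤k : 3 ≤ k) (M C : Fin n → Subset n)
              (M-sym : ∀ {v x} → x ∈ˢ M v → v ∈ˢ M x) (M-irrefl : ∀ {v} → v ∉ˢ M v)
              (∣M∣≡k : ∀ v → ∣ M v ∣ ≡ k) (M-inj : ∀ {v w} → M v ≡ M w → v ≡ w)
              (C⁺ : ∀ {x y v} → y ≢ x → x ∈ˢ M v → y ∈ˢ M v → y ∈ˢ C x)
              (C⁻ : ∀ {x y} → y ∈ˢ C x → y ≢ x × ∃[ v ] (x ∈ˢ M v × y ∈ˢ M v))
              (∣C∣≡k : ∀ x → ∣ C x ∣ ≡ k) where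

  private
    V : Set
    V = Fin n

  C≤M : ∀ {x v} → ∣ C x ∣ ≤ ∣ M v ∣
  C≤M {x} {v} = ℕ.≤-reflexive (trans (∣C∣≡k x) (sym (∣M∣≡k v)))

  infix 4 _~_

  _~_ : V → V → Set
  x ~ y = x ≡ y ⊎ y ∈ˢ C x

  _~?_ : ∀ x y → Dec (x ~ y)
  x ~? y = (x ≟ y) ⊎-dec (y Sub.∈? C x)

  common⇒~ : ∀ {x y v} → x ∈ˢ M v → y ∈ˢ M v → x ~ y
  common⇒~ {x} {y} x∈ y∈ with x ≟ y
  ... | yes x≡y = inj₁ x≡y
  ... | no  x≢y = inj₂ (C⁺ (≢-sym x≢y) x∈ y∈)

  ~-refl : ∀ {x} → x ~ x
  ~-refl = inj₁ refl

  ~-sym : ∀ {x y} → x ~ y → y ~ x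
  ~-sym (inj₁ refl) = inj₁ refl
  ~-sym (inj₂ y∈C) with C⁻ y∈C
  ... | _ , _ , x∈ , y∈ = common⇒~ y∈ x∈

  record Missing (v x : V) : Set where
    field
      point    : V
      point∈C  : point ∈ˢ C x
      point∉M  : point ∉ˢ M v
      only     : ∀ {z} → z ∈ˢ C x → z ≢ point → z ∈ˢ M v

  abstract
    -- Apart from `x`, the set `M v` has `k ∸ 1` elements, all in `C x`, which has `k`; so exactly
    -- one point of `C x` is left out. Formally, the injection of `M v` into `C x` that sends `x` to
    -- this point and fixes the rest is onto.
    missing : ∀ {v x} → x ∈ˢ M v → Missing v x
    missing {v} {x} x∈Mv with ⊈⇒∃ (C x) (M v) C⊈M
      where
      C⊈M : ¬ (C x ⊆ M v)
      C⊈M C⊆M = proj₁ (C⁻ (⊆∧card≥⇒⊇ {S = C x} {M v} C⊆M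
        (ℕ.≤-reflexive (trans (∣M∣≡k v) (sym (∣C∣≡k x)))) x∈Mv)) refl
    ... | y , y∈C , y∉M = record { point = y ; point∈C = y∈C ; point∉M = y∉M ; only = only }
      where
      ρ : V → V → Set
      ρ z z′ = (z ≡ x × z′ ≡ y) ⊎ (z ≢ x × z′ ≡ z)

      total : ∀ {z} → z ∈ˢ M v → ∃[ z′ ] (z′ ∈ˢ C x × ρ z z′)
      total {z} z∈M with z ≟ x
      ... | yes z≡x = y , y∈C , inj₁ (z≡x , refl)
      ... | no  z≢x = z , C⁺ z≢x x∈Mv z∈M , inj₂ (z≢x , refl)

      inj : ∀ {z z′ w} → z ∈ˢ M v → z′ ∈ˢ M v → ρ z w → ρ z′ w → z ≡ z′
      inj _ _ (inj₁ (refl , _)) (inj₁ (refl , _)) = refl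
      inj _ z′∈ (inj₁ (_ , refl)) (inj₂ (_ , refl)) = contradiction z′∈ y∉M
      inj z∈ _ (inj₂ (_ , refl)) (inj₁ (_ , refl)) = contradiction z∈ y∉M
      inj _ _ (inj₂ (_ , refl)) (inj₂ (_ , refl)) = refl

      only : ∀ {z} → z ∈ˢ C x → z ≢ y → z ∈ˢ M v
      only z∈C z≢y with card-onto ρ {M v} {C x} total inj C≤M z∈C
      ... | _ , _    , inj₁ (_ , refl) = contradiction refl z≢y
      ... | _ , z∈Mv , inj₂ (_ , refl) = z∈Mv

  open Missing

  -- The missing point determines `M v` as `x` together with the rest of `C x`, and hence determines
  -- `v`. It therefore injects the `k` vertices of `M x` into `C x`, which also has `k` elements.
  missing-onto : ∀ {x w} → w ∈ˢ C x → ∃[ v ] (x ∈ˢ M v × w ∉ˢ M v)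
  missing-onto {x} {w} w∈C with
    card-onto (λ v y → y ∈ˢ C x × y ∉ˢ M v) {M x} {C x} total inj C≤M w∈C
    where
    total : ∀ {v} → v ∈ˢ M x → ∃[ y ] (y ∈ˢ C x × (y ∈ˢ C x × y ∉ˢ M v))
    total v∈Mx = let m = missing (M-sym v∈Mx) in point m , point∈C m , point∈C m , point∉M m

    ⊆-by : ∀ {v v′ y} → v ∈ˢ M x → v′ ∈ˢ M x → y ∈ˢ C x → y ∉ˢ M v → y ∉ˢ M v′ →
           M v ⊆ M v′
    ⊆-by {y = y} v∈Mx v′∈Mx y∈C y∉Mv y∉Mv′ {z} z∈Mv with z ≟ x | missing (M-sym v′∈Mx)
    ... | yes refl | _  = M-sym v′∈Mx
    ... | no  z≢x  | m′ with y ≟ point m′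
    ...   | yes refl = only m′ (C⁺ z≢x (M-sym v∈Mx) z∈Mv) λ { refl → y∉Mv z∈Mv }
    ...   | no  y≢   = contradiction (only m′ y∈C y≢) y∉Mv′

    inj : ∀ {v v′ y} → v ∈ˢ M x → v′ ∈ˢ M x →
          y ∈ˢ C x × y ∉ˢ M v → y ∈ˢ C x × y ∉ˢ M v′ → v ≡ v′
    inj v∈ v′∈ (y∈C , y∉Mv) (_ , y∉Mv′) = M-inj
      (Sub.⊆-antisym (⊆-by v∈ v′∈ y∈C y∉Mv y∉Mv′) (⊆-by v′∈ v∈ y∈C y∉Mv′ y∉Mv))
  ... | v , v∈Mx , _ , w∉Mv = v , M-sym v∈Mx , w∉Mv

  -- Here `3 ≤ k` is used in full: `C y` has an element `w` other than `x` and `z`. By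
  -- `missing-onto` some `M v` contains `y` and misses only `w` from `C y`, so it contains both `x`
  -- and `z`.
  ~-trans : ∀ {x y z} → x ~ y → y ~ z → x ~ z
  ~-trans (inj₁ refl) y~z = y~z
  ~-trans x~y@(inj₂ _) (inj₁ refl) = x~y
  ~-trans {x} {y} {z} x~y@(inj₂ _) (inj₂ z∈Cy) with ~-sym x~y
  ... | inj₁ refl = inj₂ z∈Cy
  ... | inj₂ x∈Cy with avoid (C y) (x ∷ z ∷ []) (subst (2 <_) (sym (∣C∣≡k y)) 3≤k)
  ...   | w , w∈C , w∉ with missing-onto w∈C
  ...     | v , y∈Mv , w∉Mv with missing y∈Mv
  ...       | m = common⇒~ (in-M x∈Cy (w∉ ∘ here)) (in-M z∈Cy (w∉ ∘ there ∘ here))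
    where
    in-M : ∀ {u} → u ∈ˢ C y → w ≢ u → u ∈ˢ M v
    in-M {u} u∈C w≢u with w ≟ point m | u ≟ point m
    ... | no  w≢ | _        = contradiction (only m w∈C w≢) w∉Mv
    ... | yes w≡ | yes u≡   = contradiction (trans w≡ (sym u≡)) w≢u
    ... | _      | no  u≢   = only m u∈C u≢

  abstract
    neighbour : ∀ v → ∃[ x ] x ∈ˢ M v
    neighbour v = map₂ proj₁ (avoid (M v) [] (subst (0 <_) (sym (∣M∣≡k v)) (ℕ.≤-trans (s≤s z≤n) 3≤k)))

  f-missing : ∀ v → Missing v (proj₁ (neighbour v))
  f-missing v = missing (proj₂ (neighbour v))

  f : V → V
  f v = point (f-missing v)

  module _ {v z : V} where
    private
      x = proj₁ (neighbour v)

      x~fv : x ~ f v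
      x~fv = inj₂ (point∈C (f-missing v))

    ∈M⇒~f : z ∈ˢ M v → z ~ f v
    ∈M⇒~f z∈M = ~-trans (common⇒~ z∈M (proj₂ (neighbour v))) x~fv

    ∈M⇒≢f : z ∈ˢ M v → z ≢ f v
    ∈M⇒≢f z∈M refl = point∉M (f-missing v) z∈M

    ~f⇒∈M : z ~ f v → z ≢ f v → z ∈ˢ M v
    ~f⇒∈M z~fv z≢fv with ~-trans x~fv (~-sym z~fv)
    ... | inj₁ refl = proj₂ (neighbour v)
    ... | inj₂ z∈C  = only (f-missing v) z∈C z≢fv

  -- Distinct related vertices lie in a common `M u`. By symmetry `u` lies in `M v` and in `M w`,
  -- hence in the blocks of both `f v` and `f w`.
  f-resp-~ : ∀ {v w} → v ~ w → f v ~ f w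
  f-resp-~ (inj₁ refl) = ~-refl
  f-resp-~ (inj₂ w∈C) with C⁻ w∈C
  ... | _ , u , v∈Mu , w∈Mu =
    ~-trans (~-sym (∈M⇒~f (M-sym v∈Mu))) (∈M⇒~f (M-sym w∈Mu))

  -- For `w ∈ M v`, both `v ~ f w` and `w ~ f v` hold by symmetry, so `v ~ f (f v)`. If the two
  -- differed, `v` would lie in `M (f v)`, and symmetry would put `f v` into `M v`, the set that
  -- omits it.
  f-involutive : ∀ v → f (f v) ≡ v
  f-involutive v with v ≟ f (f v)
  ... | yes v≡ffv = sym v≡ffv
  ... | no  v≢ffv = contradiction refl (∈M⇒≢f (M-sym (~f⇒∈M v~ffv v≢ffv)))
    where
    v~ffv : v ~ f (f v)
    v~ffv = let (w , w∈Mv) = neighbour v in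
      ~-trans (∈M⇒~f (M-sym w∈Mv)) (f-resp-~ (∈M⇒~f w∈Mv))

  -- Otherwise `v` would lie in `M v`. Hence a block that `f` maps to itself is fixed pointwise,
  -- which makes it an independent set.
  ~f⇒≡ : ∀ {v} → v ~ f v → f v ≡ v
  ~f⇒≡ {v} v~fv with v ≟ f v
  ... | yes v≡fv = sym v≡fv
  ... | no  v≢fv = contradiction (~f⇒∈M v~fv v≢fv) M-irrefl

  block : V → List V
  block x = x ∷ elements (C x)

  length-block : ∀ x → length (block x) ≡ suc k
  length-block x = cong suc (trans (length-elements (C x)) (∣C∣≡k x))

  block-unique : ∀ x → Unique (block x)
  block-unique x = All.tabulate (λ y∈ x≡y → proj₁ (C⁻ (∈-elements⁻ (C x) y∈)) (sym x≡y))
                 ∷ elements-unique (C x)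

  elem : V → Fin (suc k) → V
  elem x p = lookup (block x) (cast (sym (length-block x)) p)

  elem-~ : ∀ x p → x ~ elem x p
  elem-~ x p with ∈-lookup {xs = block x} (cast (sym (length-block x)) p)
  ... | here eq  = inj₁ (sym eq)
  ... | there y∈ = inj₂ (∈-elements⁻ (C x) y∈)

  elem-onto : ∀ {x y} → x ~ y → ∃[ p ] elem x p ≡ y
  elem-onto {x} {y} x~y = cast (length-block x) (index y∈) ,
    trans (cong (lookup (block x)) (Fin.cast-involutive (sym (length-block x)) (length-block x) (index y∈)))
          (sym (lookup-index y∈))
    where
    ∈-block : ∀ {y} → x ~ y → y ∈ˡ block x
    ∈-block (inj₁ refl) = here refl
    ∈-block (inj₂ y∈C)  = there (∈-elements⁺ y∈C)

    y∈ = ∈-block x~y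

  elem-injective : ∀ x {p q} → elem x p ≡ elem x q → p ≡ q
  elem-injective x {p} {q} eq = begin
    p                    ≡⟨ Fin.cast-involutive |x|≡ (sym |x|≡) p ⟨
    cast |x|≡ (index′ p) ≡⟨ cong (cast |x|≡) (lookup-injective (block-unique x) {index′ p} {index′ q} eq) ⟩
    cast |x|≡ (index′ q) ≡⟨ Fin.cast-involutive |x|≡ (sym |x|≡) q ⟩
    q                    ∎
    where
    open ≡-Reasoning
    |x|≡ = length-block x
    index′ = cast (sym |x|≡)

  private
    least-~ : ∀ x → ∃[ i ] (x ~ i × (∀ {j} → x ~ j → i Fin.≤ j))
    least-~ x = least (x ~?_) (x , ~-refl)

  rep : V → V
  rep x = proj₁ (least-~ x)

  ~rep : ∀ x → x ~ rep x
  ~rep x = proj₁ (proj₂ (least-~ x))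

  rep-cong : ∀ {x y} → x ~ y → rep x ≡ rep y
  rep-cong {x} {y} x~y = Fin.≤-antisym
    (proj₂ (proj₂ (least-~ x)) (~-trans x~y (~rep y)))
    (proj₂ (proj₂ (least-~ y)) (~-trans (~-sym x~y) (~rep x)))

  -- Of two blocks exchanged by f, moved lists only the one with the smaller representative.
  fixed? : U.Decidable (λ x → rep x ≡ x × f x ≡ x)
  fixed? x = (rep x ≟ x) ×-dec (f x ≟ x)

  moved? : U.Decidable (λ x → rep x ≡ x × x Fin.< rep (f x))
  moved? x = (rep x ≟ x) ×-dec (x Fin.<? rep (f x))

  fixed moved : List V
  fixed = elements ⟪ fixed? ⟫
  moved = elements ⟪ moved? ⟫

  s t : ℕ
  s = length fixed
  t = length moved

  fixedᵢ : Fin s → V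
  fixedᵢ = lookup fixed

  movedᵢ : Fin t → V
  movedᵢ = lookup moved

  fixedᵢ⁻ : ∀ j → rep (fixedᵢ j) ≡ fixedᵢ j × f (fixedᵢ j) ≡ fixedᵢ j
  fixedᵢ⁻ j = ∈⟪⟫⁻ fixed? (∈-elements⁻ ⟪ fixed? ⟫ (∈-lookup j))

  movedᵢ⁻ : ∀ i → rep (movedᵢ i) ≡ movedᵢ i × movedᵢ i Fin.< rep (f (movedᵢ i))
  movedᵢ⁻ i = ∈⟪⟫⁻ moved? (∈-elements⁻ ⟪ moved? ⟫ (∈-lookup i))

  fixedᵢ-onto : ∀ {x} → rep x ≡ x → f x ≡ x → ∃[ j ] fixedᵢ j ≡ x
  fixedᵢ-onto p q = let x∈ = ∈-elements⁺ (∈⟪⟫⁺ fixed? (p , q)) in index x∈ , sym (lookup-index x∈)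

  movedᵢ-onto : ∀ {x} → rep x ≡ x → x Fin.< rep (f x) → ∃[ i ] movedᵢ i ≡ x
  movedᵢ-onto p q = let x∈ = ∈-elements⁺ (∈⟪⟫⁺ moved? (p , q)) in index x∈ , sym (lookup-index x∈)

  -- Positions in the second block of an exchanged pair are carried over from the first by `f`. Thus
  -- `f` preserves positions, and the pairs `v`, `f v` become the perfect matching of `H₀`.
  vertex : (Fin t × Fin 2 ⊎ Fin s) → Fin (suc k) → V
  vertex (inj₁ (i , zero))     p = elem (movedᵢ i) p
  vertex (inj₁ (i , suc zero)) p = f (elem (movedᵢ i) p)
  vertex (inj₂ j)              p = elem (fixedᵢ j) p

  vertex-f : ∀ b p → f (vertex b p) ≡ vertex (swap b) p
  vertex-f (inj₁ (i , zero))     p = refl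
  vertex-f (inj₁ (i , suc zero)) p = f-involutive _
  vertex-f (inj₂ j)              p = ~f⇒≡
    (~-trans (~-sym j~) (subst (_~ f (elem (fixedᵢ j) p)) (proj₂ (fixedᵢ⁻ j)) (f-resp-~ j~)))
    where
    j~ = elem-~ (fixedᵢ j) p

  vertex-injective : ∀ b {p q} → vertex b p ≡ vertex b q → p ≡ q
  vertex-injective (inj₁ (i , zero))     eq = elem-injective _ eq
  vertex-injective (inj₁ (i , suc zero)) eq = elem-injective _
    (trans (sym (f-involutive _)) (trans (cong f eq) (f-involutive _)))
  vertex-injective (inj₂ j)              eq = elem-injective _ eq

  base : Fin t × Fin 2 ⊎ Fin s → V
  base (inj₁ (i , zero))     = movedᵢ i
  base (inj₁ (i , suc zero)) = f (movedᵢ i)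
  base (inj₂ j)              = fixedᵢ j

  base-~ : ∀ b p → base b ~ vertex b p
  base-~ (inj₁ (i , zero))     p = elem-~ _ p
  base-~ (inj₁ (i , suc zero)) p = f-resp-~ (elem-~ _ p)
  base-~ (inj₂ j)              p = elem-~ _ p

  private
    f~f⇒~ : ∀ {x y} → f x ~ f y → x ~ y
    f~f⇒~ = subst₂ _~_ (f-involutive _) (f-involutive _) ∘ f-resp-~

    reps-~⇒≡ : ∀ {x y} → rep x ≡ x → rep y ≡ y → x ~ y → x ≡ y
    reps-~⇒≡ p q x~y = trans (sym p) (trans (rep-cong x~y) q)

    -- The blocks of `movedᵢ i` and `movedᵢ i′` would be exchanged by `f`. Since `moved` keeps the
    -- smaller representative, each of the two would be smaller than the other.
    moved≁f-moved : ∀ i i′ → ¬ (movedᵢ i ~ f (movedᵢ i′))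
    moved≁f-moved i i′ i~fi′ = Fin.<-asym i<i′ i′<i
      where
      i′<i : movedᵢ i′ Fin.< movedᵢ i
      i′<i = subst (movedᵢ i′ Fin.<_) (trans (sym (rep-cong i~fi′)) (proj₁ (movedᵢ⁻ i))) (proj₂ (movedᵢ⁻ i′))

      i<i′ : movedᵢ i Fin.< movedᵢ i′
      i<i′ = subst (movedᵢ i Fin.<_)
        (trans (rep-cong (subst (f (movedᵢ i) ~_) (f-involutive _) (f-resp-~ i~fi′))) (proj₁ (movedᵢ⁻ i′)))
        (proj₂ (movedᵢ⁻ i))

    moved≁fixed : ∀ i j → ¬ (movedᵢ i ~ fixedᵢ j)
    moved≁fixed i j i~j = Fin.<-irrefl refl (subst (movedᵢ i Fin.<_)
      (trans (rep-cong (~-trans (subst (f (movedᵢ i) ~_) (proj₂ (fixedᵢ⁻ j)) (f-resp-~ i~j)) (~-sym i~j)))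
             (proj₁ (movedᵢ⁻ i)))
      (proj₂ (movedᵢ⁻ i)))

    f-moved≁fixed : ∀ i j → ¬ (f (movedᵢ i) ~ fixedᵢ j)
    f-moved≁fixed i j fi~j = moved≁fixed i j (f~f⇒~ (subst (f (movedᵢ i) ~_) (sym (proj₂ (fixedᵢ⁻ j))) fi~j))

    moved-~⇒≡ : ∀ {i i′} → movedᵢ i ~ movedᵢ i′ → i ≡ i′
    moved-~⇒≡ i~i′ = lookup-injective (elements-unique ⟪ moved? ⟫)
      (reps-~⇒≡ (proj₁ (movedᵢ⁻ _)) (proj₁ (movedᵢ⁻ _)) i~i′)

  base-~⇒≡ : ∀ b c → base b ~ base c → b ≡ c
  base-~⇒≡ (inj₁ (i , zero))     (inj₁ (i′ , zero))     b~c = cong (λ i → inj₁ (i , zero)) (moved-~⇒≡ b~c)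
  base-~⇒≡ (inj₁ (i , zero))     (inj₁ (i′ , suc zero)) b~c = contradiction b~c (moved≁f-moved i i′)
  base-~⇒≡ (inj₁ (i , suc zero)) (inj₁ (i′ , zero))     b~c = contradiction (~-sym b~c) (moved≁f-moved i′ i)
  base-~⇒≡ (inj₁ (i , suc zero)) (inj₁ (i′ , suc zero)) b~c = cong (λ i → inj₁ (i , suc zero)) (moved-~⇒≡ (f~f⇒~ b~c))
  base-~⇒≡ (inj₁ (i , zero))     (inj₂ j)               b~c = contradiction b~c (moved≁fixed i j)
  base-~⇒≡ (inj₁ (i , suc zero)) (inj₂ j)               b~c = contradiction b~c (f-moved≁fixed i j)
  base-~⇒≡ (inj₂ j)              (inj₁ (i , zero))      b~c = contradiction (~-sym b~c) (moved≁fixed i j)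
  base-~⇒≡ (inj₂ j)              (inj₁ (i , suc zero))  b~c = contradiction (~-sym b~c) (f-moved≁fixed i j)
  base-~⇒≡ (inj₂ j)              (inj₂ j′)              b~c = cong inj₂
    (lookup-injective (elements-unique ⟪ fixed? ⟫) (reps-~⇒≡ (proj₁ (fixedᵢ⁻ j)) (proj₁ (fixedᵢ⁻ j′)) b~c))

  vertex-~⇒≡ : ∀ b p c q → vertex b p ~ vertex c q → b ≡ c
  vertex-~⇒≡ b p c q v~w =
    base-~⇒≡ b c (~-trans (base-~ b p) (~-trans v~w (~-sym (base-~ c q))))

  vertex-injective₂ : ∀ b p c q → vertex b p ≡ vertex c q → (b , p) ≡ (c , q)
  vertex-injective₂ b p c q eq with vertex-~⇒≡ b p c q (inj₁ eq)
  ... | refl = cong (b ,_) (vertex-injective b eq)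

  vertex-onto : ∀ x → ∃[ b ] ∃[ p ] vertex b p ≡ x
  -- The smaller representative decides the label: the block of `x` is the first of an exchanged
  -- pair, a fixed block, or the second of a pair. In the last case `f x` is located in the first
  -- block and mapped back by `f`.
  vertex-onto x with Fin.<-cmp (rep x) (rep (f x))
  ... | tri< ρ<σ _ _ = let
      (i , i≡) = movedᵢ-onto (rep-cong (~-sym (~rep x)))
                   (subst (rep x Fin.<_) (rep-cong (f-resp-~ (~rep x))) ρ<σ)
      (p , p≡) = elem-onto (subst (_~ x) (sym i≡) (~-sym (~rep x)))
    in inj₁ (i , zero) , p , p≡
  ... | tri≈ _ ρ≡σ _ = let
      x~fx = ~-trans (~rep x) (subst (_~ f x) (sym ρ≡σ) (~-sym (~rep (f x))))
      (j , j≡) = fixedᵢ-onto (rep-cong (~-sym (~rep x)))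
                   (~f⇒≡ (~-trans (~-sym (~rep x)) (~-trans x~fx (f-resp-~ (~rep x)))))
      (p , p≡) = elem-onto (subst (_~ x) (sym j≡) (~-sym (~rep x)))
    in inj₂ j , p , p≡
  ... | tri> _ _ σ<ρ = let
      fσ~x = subst (f (rep (f x)) ~_) (f-involutive x) (f-resp-~ (~-sym (~rep (f x))))
      (i , i≡) = movedᵢ-onto (rep-cong (~-sym (~rep (f x))))
                   (subst (rep (f x) Fin.<_) (sym (rep-cong fσ~x)) σ<ρ)
      (p , p≡) = elem-onto (subst (_~ f x) (sym i≡) (~-sym (~rep (f x))))
    in inj₁ (i , suc zero) , p , trans (cong f p≡) (f-involutive x)

  vertex-∈M : ∀ b p c q → vertex c q ∈ˢ M (vertex b p) ⇔ (c ≡ swap b × q ≢ p)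
  vertex-∈M b p c q = mk⇔ to from
    where
    to : vertex c q ∈ˢ M (vertex b p) → c ≡ swap b × q ≢ p
    to w∈M with vertex-~⇒≡ c q (swap b) p (subst (vertex c q ~_) (vertex-f b p) (∈M⇒~f w∈M))
    ... | refl = refl , λ { refl → ∈M⇒≢f w∈M (sym (vertex-f b p)) }

    from : c ≡ swap b × q ≢ p → vertex c q ∈ˢ M (vertex b p)
    from (refl , q≢p) = ~f⇒∈M
      (subst (vertex c q ~_) (sym (vertex-f b p)) (~-trans (~-sym (base-~ c q)) (base-~ c p)))
      λ eq → q≢p (vertex-injective c (trans eq (vertex-f b p)))

  vertex↔ : ((Fin t × Fin 2 ⊎ Fin s) × Fin (suc k)) ↔ V
  vertex↔ = mk↔ₛ′ (λ (b , p) → vertex b p)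
    (λ x → let (b , p , _) = vertex-onto x in b , p)
    (λ x → proj₂ (proj₂ (vertex-onto x)))
    (λ (b , p) → let (c , q , eq) = vertex-onto (vertex b p) in vertex-injective₂ c q b p eq)

  Labelling : Set
  Labelling = ∃[ t ] ∃[ s ] Σ[ v ∈ ((Fin t × Fin 2 ⊎ Fin s) × Fin (suc k)) ↔ V ]
    (∀ b p c q → Inverse.to v (c , q) ∈ˢ M (Inverse.to v (b , p)) ⇔ (c ≡ swap b × q ≢ p))

  labelling : Labelling
  labelling = t , s , vertex↔ , vertex-∈M

-- Isomorphisms and labelled models of non-adjacency

↔-injective : (f : A ↔ B) → ∀ {x y} → Inverse.to f x ≡ Inverse.to f y → x ≡ y
↔-injective f = Injection.injective (↔⇒↣ f)

∈M-resp-≅ : ∀ G H (iso : G ≅ H) → let open Inverse (proj₁ iso) in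
            ∀ x y → y ∈ˢ M G x ⇔ to y ∈ˢ M H (to x)
∈M-resp-≅ G H (f , adj) x y = mk⇔
  (λ y∈Mx → ∈M⁺ H λ { (inj₁ fx≡fy) → ∈M⁻ G y∈Mx (inj₁ (↔-injective f fx≡fy))
                    ; (inj₂ e)     → ∈M⁻ G y∈Mx (inj₂ (⇐ (adj y x) e)) })
  (λ fy∈Mfx → ∈M⁺ G λ { (inj₁ refl) → M-irrefl H fy∈Mfx
                      ; (inj₂ e)    → ∈M⁻ H fy∈Mfx (inj₂ (⇒ (adj y x) e)) })
  where
  open Inverse f

Adj⇔∉M : ∀ G x y → Adj G x y ⇔ (x ≢ y × y ∉ˢ M G x)
Adj⇔∉M G x y = mk⇔
  (λ e → (λ x≡y → irrefl G x≡y e) , λ y∈Mx → ∈M⁻ G y∈Mx (inj₂ (symm G e)))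
  (λ (x≢y , y∉Mx) → decidable-stable (adj? G x y) λ ¬e →
    y∉Mx (∈M⁺ G λ { (inj₁ x≡y) → x≢y x≡y ; (inj₂ e) → ¬e (symm G e) }))

-- A description of the non-adjacency of G: B indexes the colour classes of size a, and a vertex
-- is non-adjacent exactly to the vertices of class φ b in a different position.  A fixed class
-- of φ is independent, and two classes swapped by φ induce a copy of H₀ a.
record Model (G : Graph) {B : Set} (φ : B → B) (a : ℕ) : Set where
  field
    label : (B × Fin a) ↔ Vertex G

  vertex : B × Fin a → Vertex G
  vertex = Inverse.to label

  field
    ∈M⇔ : ∀ b p c q → vertex (c , q) ∈ˢ M G (vertex (b , p)) ⇔ (c ≡ φ b × q ≢ p)

  coords : Vertex G → B × Fin a
  coords = Inverse.from label

  vertex-coords : ∀ x → vertex (coords x) ≡ x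
  vertex-coords = Inverse.strictlyInverseˡ label

  coords-vertex : ∀ l → coords (vertex l) ≡ l
  coords-vertex = Inverse.strictlyInverseʳ label

  coords-injective : ∀ {x y} → coords x ≡ coords y → x ≡ y
  coords-injective {x} {y} eq = trans (sym (vertex-coords x)) (trans (cong vertex eq) (vertex-coords y))

  ∈M⇔′ : ∀ x y → y ∈ˢ M G x ⇔
         (proj₁ (coords y) ≡ φ (proj₁ (coords x)) × proj₂ (coords y) ≢ proj₂ (coords x))
  ∈M⇔′ x y = subst₂
    (λ u v → v ∈ˢ M G u ⇔
             (proj₁ (coords y) ≡ φ (proj₁ (coords x)) × proj₂ (coords y) ≢ proj₂ (coords x)))
    (vertex-coords x) (vertex-coords y) (∈M⇔ _ _ _ _)

open Model

relabel : ∀ {G a} {φ : B → B} {ψ : B′ → B′} (β : B′ ↔ B) →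
          (∀ b → Inverse.to β (ψ b) ≡ φ (Inverse.to β b)) → Model G φ a → Model G ψ a
relabel {φ = φ} {ψ} β comm m = record
  { label = label m ↔-∘ (β ×-↔ ↔-id _)
  ; ∈M⇔   = λ b p c q → mk⇔
      (λ w∈ → let (eq , q≢p) = ⇒ (∈M⇔ m _ _ _ _) w∈ in ↔-injective β (trans eq (sym (comm b))) , q≢p)
      (λ { (refl , q≢p) → ⇐ (∈M⇔ m _ _ _ _) (comm b , q≢p) })
  }

model-resp-≅ : ∀ G H {a} {φ : B → B} → G ≅ H → Model H φ a → Model G φ a
model-resp-≅ G H iso@(f , _) m = record
  { label = ↔-sym f ↔-∘ label m
  ; ∈M⇔   = λ b p c q → ∈M⇔ m b p c q ⇔-∘
      subst₂ (λ u v → _ ∈ˢ M G _ ⇔ v ∈ˢ M H u) (strictlyInverseˡ _) (strictlyInverseˡ _)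
        (∈M-resp-≅ G H iso _ _)
  }
  where open Inverse f

-- Vertices with equal labels are matched. The labels determine every `M`, and `Adj⇔∉M` recovers
-- adjacency from it.
models⇒≅ : ∀ G H {a} {φ : B → B} → Model G φ a → Model H φ a → G ≅ H
models⇒≅ G H m m′ = f , λ x y → ⇔-sym (Adj⇔∉M H _ _) ⇔-∘ (step x y ⇔-∘ Adj⇔∉M G x y)
  where
  f : Vertex G ↔ Vertex H
  f = label m′ ↔-∘ ↔-sym (label m)

  open Inverse f

  ∈M-to : ∀ x y → y ∈ˢ M G x ⇔ to y ∈ˢ M H (to x)
  ∈M-to x y = ⇔-sym (∈M⇔ m′ _ _ _ _) ⇔-∘ ∈M⇔′ m x y

  step : ∀ x y → (x ≢ y × y ∉ˢ M G x) ⇔ (to x ≢ to y × to y ∉ˢ M H (to x))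
  step x y = mk⇔ (Product.map (_∘ ↔-injective f) (_∘ ⇐ (∈M-to x y)))
                 (Product.map (_∘ cong to) (_∘ ⇒ (∈M-to x y)))

-- Dominating sets in a model

module _ {G a} {φ : B → B} (m : Model G φ a) (φ-involutive : ∀ b → φ (φ b) ≡ b) where

  -- The vertex labelled `(φ c , p)` is undominated exactly when `S` lies in class `c` without
  -- position `p`. As `φ` is an involution, `φ c` runs over all classes and `φ` drops out of the
  -- criterion; this is why the graphs `J r a t` with the same `r` and `a` share one polynomial.
  dominating⇔ : ∀ S → Dominating G S ⇔
                (∀ c p → ∃[ b ] ∃[ q ] (vertex m (b , q) ∈ˢ S × ¬ (b ≡ c × q ≢ p)))
  dominating⇔ S = mk⇔ to from
    where
    to : Dominating G S → ∀ c p → ∃[ b ] ∃[ q ] (vertex m (b , q) ∈ˢ S × ¬ (b ≡ c × q ≢ p))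
    to dom c p with dom (vertex m (φ c , p))
    ... | x , x∈S , xv = _ , _ , subst (_∈ˢ S) (sym (vertex-coords m x)) x∈S , λ (b≡c , q≢p) →
      ∈M⁻ G (⇐ (∈M⇔ m (φ c) p _ _) (trans b≡c (sym (φ-involutive c)) , q≢p))
            (subst (λ u → N[_] G u (vertex m (φ c , p))) (sym (vertex-coords m x)) xv)

    from : (∀ c p → ∃[ b ] ∃[ q ] (vertex m (b , q) ∈ˢ S × ¬ (b ≡ c × q ≢ p))) → Dominating G S
    from hit v with hit (φ (proj₁ (coords m v))) (proj₂ (coords m v))
    ... | b , q , x∈S , ¬bq = x , x∈S ,
      decidable-stable ((v ≟ x) ⊎-dec adj? G x v) λ ¬xv →
        ¬bq (subst (λ l → proj₁ l ≡ φ (proj₁ (coords m v)) × proj₂ l ≢ proj₂ (coords m v))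
              (coords-vertex m (b , q)) (⇒ (∈M⇔′ m v x) (∈M⁺ G ¬xv)))
      where x = vertex m (b , q)

image : Fin n ↔ Fin n′ → Subset n → Subset n′
image θ S = ⟪ (λ y → Inverse.from θ y Sub.∈? S) ⟫

module _ (θ : Fin n ↔ Fin n′) where
  open Inverse θ

  ∈-image⁺ : ∀ {S x} → x ∈ˢ S → to x ∈ˢ image θ S
  ∈-image⁺ {S} {x} x∈S = ∈⟪⟫⁺ (λ y → from y Sub.∈? S) (subst (_∈ˢ S) (sym (strictlyInverseʳ x)) x∈S)

  ∈-image⁻ : ∀ S {y} → y ∈ˢ image θ S → from y ∈ˢ S
  ∈-image⁻ S = ∈⟪⟫⁻ (λ y → from y Sub.∈? S)

  ∣image∣ : ∀ S → ∣ image θ S ∣ ≡ ∣ S ∣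
  ∣image∣ S = ℕ.≤-antisym
    (card-≤ (λ y x → x ≡ from y) {image θ S} {S} (λ y∈ → _ , ∈-image⁻ S y∈ , refl)
      λ _ _ p q → ↔-injective (↔-sym θ) (trans (sym p) q))
    (card-≤ (λ x y → y ≡ to x) {S} {image θ S} (λ x∈ → _ , ∈-image⁺ x∈ , refl)
      λ _ _ p q → ↔-injective θ (trans (sym p) q))

  image-reflects-⊆ : ∀ S T → image θ S ≡ image θ T → S ⊆ T
  image-reflects-⊆ S T eq {x} x∈S =
    subst (_∈ˢ T) (strictlyInverseʳ x) (∈-image⁻ T (subst (to x ∈ˢ_) eq (∈-image⁺ x∈S)))

d-mono : ∀ G H (θ : Vertex G ↔ Vertex H) →
         (∀ S → Dominating G S → Dominating H (image θ S)) → ∀ i → d G i ≤ d H i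
d-mono G H θ dom i = pigeonhole-≤ (λ S T → T ≡ image θ S)
  (Unique.filter⁺ _ (subsets-unique (order G))) total
  (λ {S} {S′} _ _ p q → Sub.⊆-antisym (image-reflects-⊆ θ S S′ (trans (sym p) q))
                                       (image-reflects-⊆ θ S′ S (trans (sym q) p)))
  where
  total : ∀ {S} → S ∈ˡ filter (λ S → dominating? G S ×-dec (∣ S ∣ ℕ.≟ i)) (subsets (order G)) →
          ∃[ T ] (T ∈ˡ filter (λ T → dominating? H T ×-dec (∣ T ∣ ℕ.≟ i)) (subsets (order H)) × T ≡ image θ S)
  total {S} S∈ with ∈-filter⁻ (λ S → dominating? G S ×-dec (∣ S ∣ ℕ.≟ i)) {xs = subsets (order G)} S∈
  ... | _ , domS , ∣S∣≡i = _ , ∈-filter⁺ _ (∈-subsets (image θ S)) (dom S domS , trans (∣image∣ θ S) ∣S∣≡i) , refl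

-- The involutions may differ: in terms of labels, `dominating⇔` states the same condition for both
-- graphs, so the bijection matching labels preserves domination.
models⇒d≤ : ∀ G H {a} {φ ψ : B → B} → (∀ b → φ (φ b) ≡ b) → (∀ b → ψ (ψ b) ≡ b) →
            Model G φ a → Model H ψ a → ∀ i → d G i ≤ d H i
models⇒d≤ G H φφ ψψ m m′ = d-mono G H θ λ S dom →
  ⇐ (dominating⇔ m′ ψψ (image θ S)) λ c p →
    let (b , q , x∈S , ¬bq) = ⇒ (dominating⇔ m φφ S) dom c p in
    b , q , subst (_∈ˢ image θ S) (cong (vertex m′) (coords-vertex m (b , q))) (∈-image⁺ θ x∈S) , ¬bq
  where
  θ : Vertex G ↔ Vertex H
  θ = label m′ ↔-∘ ↔-sym (label m)

-- Coefficients of the domination polynomial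

d-large : ∀ G {i} → order G < i → d G i ≡ 0
d-large G {i} n<i = cong length (List.filter-none (λ S → dominating? G S ×-dec (∣ S ∣ ℕ.≟ i))
  (All.tabulate {xs = subsets (order G)} λ {S} _ (_ , ∣S∣≡i) →
    ℕ.<⇒≱ n<i (subst (_≤ order G) ∣S∣≡i (Sub.∣p∣≤n S))))

d-order : ∀ G → 0 < d G (order G)
d-order G = ∈-length (∈-filter⁺ (λ S → dominating? G S ×-dec (∣ S ∣ ℕ.≟ order G)) (∈-subsets ⊤)
  ((λ v → v , Sub.∈⊤ , inj₁ refl) , Sub.∣⊤∣≡n (order G)))

coeff-applyUpTo : ∀ (g : ℕ → ℕ) n i → (n ≤ i → g i ≡ 0) → coeff (applyUpTo g n) i ≡ g i
coeff-applyUpTo g zero    i       g≡0 = sym (g≡0 z≤n)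
coeff-applyUpTo g (suc n) zero    g≡0 = refl
coeff-applyUpTo g (suc n) (suc i) g≡0 = coeff-applyUpTo (g ∘ suc) n i (g≡0 ∘ s≤s)

coeff-D : ∀ G i → coeff (D G) (suc i) ≡ d G (suc i)
coeff-D G i = coeff-applyUpTo (λ i → d G (suc i)) (order G) i (d-large G ∘ s≤s)

d≡⇒∼ᴰ : ∀ G H → (∀ i → d G i ≡ d H i) → G ∼ᴰ H
d≡⇒∼ᴰ G H eq zero    = refl
d≡⇒∼ᴰ G H eq (suc i) = trans (coeff-D G i) (trans (eq (suc i)) (sym (coeff-D H i)))

∼ᴰ⇒d≡ : ∀ G H → G ∼ᴰ H → ∀ i → d G (suc i) ≡ d H (suc i)
∼ᴰ⇒d≡ G H eq i = trans (sym (coeff-D G i)) (trans (eq (suc i)) (coeff-D H i))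

-- The order is the degree of `D`: the full vertex set dominates, and `d H` vanishes above the order
-- of `H`. Order zero is split off because `D` has constant term 0 by definition, so only positive
-- indices can be compared.
∼ᴰ⇒order≤ : ∀ G H → G ∼ᴰ H → order G ≤ order H
∼ᴰ⇒order≤ G H eq = bound (order G) refl
  where
  bound : ∀ n → n ≡ order G → n ≤ order H
  bound zero    _  = z≤n
  bound (suc n) n≡ = ℕ.≮⇒≥ λ H<G → contradiction
    (subst (0 <_) (trans (∼ᴰ⇒d≡ G H eq n) (d-large H H<G)) (subst (λ i → 0 < d G i) (sym n≡) (d-order G)))
    λ ()

∼ᴰ⇒nonDominating≡ : ∀ G H → G ∼ᴰ H → ∀ i →
  length (nonDominating G (suc i)) ≡ length (nonDominating H (suc i))
∼ᴰ⇒nonDominating≡ G H eq i = ℕ.+-cancelˡ-≡ (d H (suc i)) _ _ (begin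
  d H (suc i) + length (nonDominating G (suc i)) ≡⟨ cong (_+ _) (∼ᴰ⇒d≡ G H eq i) ⟨
  d G (suc i) + length (nonDominating G (suc i)) ≡⟨ d+nonDominating G (suc i) ⟨
  length (filter (λ S → ∣ S ∣ ℕ.≟ suc i) (subsets (order G)))
    ≡⟨ cong (λ n → length (filter (λ S → ∣ S ∣ ℕ.≟ suc i) (subsets n))) order≡ ⟩
  length (filter (λ S → ∣ S ∣ ℕ.≟ suc i) (subsets (order H))) ≡⟨ d+nonDominating H (suc i) ⟩
  d H (suc i) + length (nonDominating H (suc i)) ∎)
  where
  open ≡-Reasoning
  order≡ : order G ≡ order H
  order≡ = ℕ.≤-antisym (∼ᴰ⇒order≤ G H eq) (∼ᴰ⇒order≤ H G (λ i → sym (eq i)))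

-- Models of `𝒦`, `H₀`, joins and `J`

model-𝒦 : ∀ r a → Model (𝒦 r a) {Fin r} id a
model-𝒦 r a = record
  { label = ↔-sym Fin.*↔×
  ; ∈M⇔   = λ b p c q → mk⇔ (∈M⇒ b p c q) (⇒∈M b p c q)
  }
  where
  class-combine : ∀ b p → Fin.quotient {r} a (combine b p) ≡ b
  class-combine b p = cong proj₁ (Fin.remQuot-combine b p)

  ∈M⇒ : ∀ b p c q → combine c q ∈ˢ M (𝒦 r a) (combine b p) → c ≡ b × q ≢ p
  ∈M⇒ b p c q w∈ with c ≟ b
  ... | yes refl = refl , λ { refl → M-irrefl (𝒦 r a) w∈ }
  ... | no  c≢b  = contradiction
    (inj₂ λ eq → c≢b (trans (sym (class-combine c q)) (trans eq (class-combine b p)))) (∈M⁻ (𝒦 r a) w∈)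

  ⇒∈M : ∀ b p c q → c ≡ b × q ≢ p → combine c q ∈ˢ M (𝒦 r a) (combine b p)
  ⇒∈M b p .b q (refl , q≢p) = ∈M⁺ (𝒦 r a)
    λ { (inj₁ eq) → q≢p (sym (proj₂ (Fin.combine-injective b p b q eq)))
      ; (inj₂ ne) → ne (trans (class-combine b q) (sym (class-combine b p))) }

-- A vertex is non-adjacent exactly to the other copy of the complete graph without its match. The
-- two copies therefore serve as the classes, exchanged by `opposite`.
model-H₀ : ∀ a → Model (H₀ a) opposite a
model-H₀ a = record
  { label = ↔-sym Fin.*↔×
  ; ∈M⇔   = λ b p c q → mk⇔ (∈M⇒ b p c q) (⇒∈M b p c q)
  }
  where
  H₀Adj : Fin 2 × Fin a → Fin 2 × Fin a → Set
  H₀Adj (b , p) (c , q) = (b ≡ c × p ≢ q) ⊎ (b ≢ c × p ≡ q)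

  Adj⇔ : ∀ b p c q → Adj (H₀ a) (combine b p) (combine c q) ⇔ H₀Adj (b , p) (c , q)
  Adj⇔ b p c q = subst₂ (λ u v → Adj (H₀ a) (combine b p) (combine c q) ⇔ H₀Adj u v)
    (Fin.remQuot-combine b p) (Fin.remQuot-combine c q) (mk⇔ id id)

  ≡-or-opposite : (c b : Fin 2) → (c ≡ b × c ≢ opposite b) ⊎ (c ≢ b × c ≡ opposite b)
  ≡-or-opposite zero       zero       = inj₁ (refl , λ ())
  ≡-or-opposite zero       (suc zero) = inj₂ ((λ ()) , refl)
  ≡-or-opposite (suc zero) zero       = inj₂ ((λ ()) , refl)
  ≡-or-opposite (suc zero) (suc zero) = inj₁ (refl , λ ())

  ∈M⇒ : ∀ b p c q → combine c q ∈ˢ M (H₀ a) (combine b p) → c ≡ opposite b × q ≢ p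
  ∈M⇒ b p c q w∈ with ≡-or-opposite c b | q ≟ p
  ... | inj₁ (refl , _) | yes refl = contradiction w∈ (M-irrefl (H₀ a))
  ... | inj₁ (c≡b , _)  | no  q≢p  =
    contradiction (inj₂ (⇐ (Adj⇔ c q b p) (inj₁ (c≡b , q≢p)))) (∈M⁻ (H₀ a) w∈)
  ... | inj₂ (c≢b , _)  | yes q≡p  =
    contradiction (inj₂ (⇐ (Adj⇔ c q b p) (inj₂ (c≢b , q≡p)))) (∈M⁻ (H₀ a) w∈)
  ... | inj₂ (_ , c≡b′) | no  q≢p  = c≡b′ , q≢p

  ⇒∈M : ∀ b p c q → c ≡ opposite b × q ≢ p → combine c q ∈ˢ M (H₀ a) (combine b p)
  ⇒∈M b p c q (c≡b′ , q≢p) = ∈M⁺ (H₀ a)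
    λ { (inj₁ eq) → q≢p (sym (proj₂ (Fin.combine-injective b p c q eq)))
      ; (inj₂ e) → case ⇒ (Adj⇔ c q b p) e of λ
          { (inj₁ (c≡b , _)) → case ≡-or-opposite c b of λ
              { (inj₁ (_ , c≢b′)) → c≢b′ c≡b′ ; (inj₂ (c≢b , _)) → c≢b c≡b }
          ; (inj₂ (_ , q≡p)) → q≢p q≡p } }

module _ (G H : Graph) where

  JoinM : Rel (Vertex G ⊎ Vertex H) _
  JoinM (inj₁ x) (inj₁ y) = y ∈ˢ M G x
  JoinM (inj₁ _) (inj₂ _) = Empty.⊥
  JoinM (inj₂ _) (inj₁ _) = Empty.⊥
  JoinM (inj₂ x) (inj₂ y) = y ∈ˢ M H x

  ∈M-∨ : ∀ u w → join (order G) (order H) w ∈ˢ M (G ∨ H) (join (order G) (order H) u) ⇔ JoinM u w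
  ∈M-∨ u w = mk⇔ (to u w ∘ nonAdj) (λ uw → ∈M⁺ (G ∨ H)
    λ { (inj₁ eq) → from u w uw (inj₁ (join-injective eq))
      ; (inj₂ e)  → from u w uw (inj₂ (subst₂ (JoinAdj G H) (split w) (split u) e)) })
    where
    split : ∀ u → Fin.splitAt (order G) (join (order G) (order H) u) ≡ u
    split = Fin.splitAt-join (order G) (order H)

    join-injective : ∀ {u w} → join (order G) (order H) u ≡ join (order G) (order H) w → u ≡ w
    join-injective {u} {w} eq = trans (sym (split u)) (trans (cong (Fin.splitAt (order G)) eq) (split w))

    nonAdj : join (order G) (order H) w ∈ˢ M (G ∨ H) (join (order G) (order H) u) → ¬ (u ≡ w ⊎ JoinAdj G H w u)
    nonAdj w∈ (inj₁ eq) = ∈M⁻ (G ∨ H) w∈ (inj₁ (cong (join (order G) (order H)) eq))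
    nonAdj w∈ (inj₂ e)  = ∈M⁻ (G ∨ H) w∈ (inj₂ (subst₂ (JoinAdj G H) (sym (split w)) (sym (split u)) e))

    to : ∀ u w → ¬ (u ≡ w ⊎ JoinAdj G H w u) → JoinM u w
    to (inj₁ x) (inj₁ y) ¬xy = ∈M⁺ G (¬xy ∘ Sum.map₁ (cong inj₁))
    to (inj₁ x) (inj₂ y) ¬xy = ¬xy (inj₂ _)
    to (inj₂ x) (inj₁ y) ¬xy = ¬xy (inj₂ _)
    to (inj₂ x) (inj₂ y) ¬xy = ∈M⁺ H (¬xy ∘ Sum.map₁ (cong inj₂))

    from : ∀ u w → JoinM u w → ¬ (u ≡ w ⊎ JoinAdj G H w u)
    from (inj₁ x) (inj₁ y) y∈ (inj₁ refl) = M-irrefl G y∈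
    from (inj₁ x) (inj₁ y) y∈ (inj₂ e)    = ∈M⁻ G y∈ (inj₂ e)
    from (inj₂ x) (inj₂ y) y∈ (inj₁ refl) = M-irrefl H y∈
    from (inj₂ x) (inj₂ y) y∈ (inj₂ e)    = ∈M⁻ H y∈ (inj₂ e)

model-∨ : ∀ {G H a} {φ : B → B} {ψ : B′ → B′} →
          Model G φ a → Model H ψ a → Model (G ∨ H) (Sum.map φ ψ) a
model-∨ {G = G} {H} {a} {φ} {ψ} m m′ = record
  { label = ↔-sym Fin.+↔⊎ ↔-∘ ((label m ⊎-↔ label m′) ↔-∘ ×-distribʳ-⊎)
  ; ∈M⇔   = λ { (inj₁ b) p (inj₁ c) q → side₁ b c ⇔-∘ (∈M⇔ m b p c q ⇔-∘ ∈M-∨ G H (inj₁ _) (inj₁ _))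
              ; (inj₁ b) p (inj₂ c) q → mk⇔ (λ ()) (λ ()) ⇔-∘ ∈M-∨ G H (inj₁ _) (inj₂ _)
              ; (inj₂ b) p (inj₁ c) q → mk⇔ (λ ()) (λ ()) ⇔-∘ ∈M-∨ G H (inj₂ _) (inj₁ _)
              ; (inj₂ b) p (inj₂ c) q → side₂ b c ⇔-∘ (∈M⇔ m′ b p c q ⇔-∘ ∈M-∨ G H (inj₂ _) (inj₂ _)) }
  }
  where
  side₁ : ∀ b c {Q : Set} → (c ≡ φ b × Q) ⇔ (inj₁ c ≡ Sum.map φ ψ (inj₁ b) × Q)
  side₁ b c = mk⇔ (Product.map₁ (cong inj₁)) (λ { (refl , q) → refl , q })

  side₂ : ∀ b c {Q : Set} → (c ≡ ψ b × Q) ⇔ (inj₂ c ≡ Sum.map φ ψ (inj₂ b) × Q)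
  side₂ b c = mk⇔ (Product.map₁ (cong inj₂)) (λ { (refl , q) → refl , q })

model-⋁H₀ : ∀ t a → Model (⋁ (replicate t (H₀ a))) {Fin t × Fin 2} (map₂ opposite) a
model-⋁H₀ zero    a = record
  { label = mk↔ₛ′ (λ { ((() , _) , _) }) (λ ()) (λ ()) (λ { ((() , _) , _) })
  ; ∈M⇔   = λ { (() , _) }
  }
model-⋁H₀ (suc t) a = relabel β comm (model-∨ (model-H₀ a) (model-⋁H₀ t a))
  where
  β : (Fin (suc t) × Fin 2) ↔ (Fin 2 ⊎ Fin t × Fin 2)
  β = mk↔ₛ′ (λ { (zero , c) → inj₁ c ; (suc i , c) → inj₂ (i , c) })
            (λ { (inj₁ c) → zero , c ; (inj₂ (i , c)) → suc i , c })
            (λ { (inj₁ _) → refl ; (inj₂ _) → refl })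
            (λ { (zero , _) → refl ; (suc _ , _) → refl })

  comm : ∀ b → Inverse.to β (map₂ opposite b) ≡ Sum.map opposite (map₂ opposite) (Inverse.to β b)
  comm (zero  , _) = refl
  comm (suc _ , _) = refl

model-J : ∀ r a t → Model (J r a t) {Fin t × Fin 2 ⊎ Fin (r ∸ 2 * t)} swap a
model-J r a t = model-∨ (model-⋁H₀ t a) (model-𝒦 (r ∸ 2 * t) a)

swap-involutive : ∀ (b : A × Fin 2 ⊎ B) → swap (swap b) ≡ b
swap-involutive (inj₁ (i , c)) = cong (λ c → inj₁ (i , c)) (Fin.opposite-involutive c)
swap-involutive (inj₂ j)       = refl

labels↔ : ∀ t s → (Fin t × Fin 2 ⊎ Fin s) ↔ Fin (t * 2 + s)
labels↔ t s = ↔-sym Fin.+↔⊎ ↔-∘ (↔-sym Fin.*↔× ⊎-↔ ↔-id _)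

model⇒∼ᴰ : ∀ G {t s a} → Model G {Fin t × Fin 2 ⊎ Fin s} swap a → G ∼ᴰ 𝒦 (t * 2 + s) a
model⇒∼ᴰ G {t} {s} {a} m = d≡⇒∼ᴰ G (𝒦 (t * 2 + s) a) λ i → ℕ.≤-antisym
  (models⇒d≤ G (𝒦 (t * 2 + s) a) swap-involutive (λ _ → refl) m m𝒦 i)
  (models⇒d≤ (𝒦 (t * 2 + s) a) G (λ _ → refl) swap-involutive m𝒦 m i)
  where
  -- The identity commutes with every relabelling, so the colour classes of `𝒦` can carry the labels
  -- of `G`. The two models then differ only in their involutions.
  m𝒦 : Model (𝒦 (t * 2 + s) a) {Fin t × Fin 2 ⊎ Fin s} id a
  m𝒦 = relabel (labels↔ t s) (λ _ → refl) (model-𝒦 (t * 2 + s) a)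

-- Non-dominating sets of a model, and of `𝒦` in particular

module _ {G k} {φ : B → B} (m : Model G φ (suc k)) (φ-involutive : ∀ b → φ (φ b) ≡ b) where

  opposite-∈M : ∀ v {q} → q ≢ proj₂ (coords m v) → vertex m (φ (proj₁ (coords m v)) , q) ∈ˢ M G v
  opposite-∈M v {q} q≢p = subst (λ u → vertex m (φ (proj₁ (coords m v)) , q) ∈ˢ M G u)
    (vertex-coords m v) (⇐ (∈M⇔ m _ _ _ q) (refl , q≢p))

  model⇒∣M∣≡ : ∀ v → ∣ M G v ∣ ≡ k
  model⇒∣M∣≡ v = trans (ℕ.≤-antisym M≤ M≥) ∣others∣
    where
    b = proj₁ (coords m v)
    p = proj₂ (coords m v)

    ∣others∣ : ∣ ∁ ⁅ p ⁆ ∣ ≡ k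
    ∣others∣ = trans (Sub.∣∁p∣≡n∸∣p∣ ⁅ p ⁆) (cong (suc k ∸_) (Sub.∣⁅x⁆∣≡1 p))

    M≤ : ∣ M G v ∣ ≤ ∣ ∁ ⁅ p ⁆ ∣
    M≤ = card-≤ (λ x q → x ≡ vertex m (φ b , q)) {M G v} {∁ ⁅ p ⁆}
      (λ {x} x∈M → let (eq , q≢p) = ⇒ (∈M⇔′ m v x) x∈M in
        _ , Sub.x∉p⇒x∈∁p (q≢p ∘ Sub.x∈⁅y⁆⇒x≡y p)
          , trans (sym (vertex-coords m x)) (cong (λ c → vertex m (c , _)) eq))
      (λ _ _ e e′ → trans e (sym e′))

    M≥ : ∣ ∁ ⁅ p ⁆ ∣ ≤ ∣ M G v ∣
    M≥ = card-≤ (λ q x → x ≡ vertex m (φ b , q)) {∁ ⁅ p ⁆} {M G v}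
      (λ {q} q∈ → _ , opposite-∈M v (λ { refl → Sub.x∈∁p⇒x∉p q∈ (Sub.x∈⁅x⁆ q) }) , refl)
      (λ {q} {q′} _ _ e e′ → cong proj₂ (trans (sym (coords-vertex m (φ b , q)))
        (trans (cong (coords m) (trans (sym e) e′)) (coords-vertex m (φ b , q′)))))

  -- Any element of `M G v` reveals the class of `v` through `φ`, and the position of `v` is the one
  -- that does not occur in `M G v`.
  model⇒M-injective : 1 ≤ k → ∀ {v w} → M G v ≡ M G w → v ≡ w
  model⇒M-injective 1≤k {v} {w} Mv≡Mw with avoid (M G v) [] (subst (0 <_) (sym (model⇒∣M∣≡ v)) 1≤k)
  ... | z , z∈Mv , _ = coords-injective m (cong₂ _,_ same-block same-pos)
    where
    q = proj₂ (coords m w)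

    same-block : proj₁ (coords m v) ≡ proj₁ (coords m w)
    same-block = begin
      proj₁ (coords m v)          ≡⟨ φ-involutive _ ⟨
      φ (φ (proj₁ (coords m v)))  ≡⟨ cong φ (proj₁ (⇒ (∈M⇔′ m v z) z∈Mv)) ⟨
      φ (proj₁ (coords m z))      ≡⟨ cong φ (proj₁ (⇒ (∈M⇔′ m w z) (subst (z ∈ˢ_) Mv≡Mw z∈Mv))) ⟩
      φ (φ (proj₁ (coords m w)))  ≡⟨ φ-involutive _ ⟩
      proj₁ (coords m w)          ∎
      where open ≡-Reasoning

    same-pos : proj₂ (coords m v) ≡ q
    same-pos with proj₂ (coords m v) ≟ q
    ... | yes p≡q = p≡q
    ... | no  p≢q = contradiction (cong proj₂ (coords-vertex m (_ , q)))
      (proj₂ (⇒ (∈M⇔′ m w u) (subst (u ∈ˢ_) Mv≡Mw (opposite-∈M v (≢-sym p≢q)))))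
      where u = vertex m (φ (proj₁ (coords m v)) , q)

module _ (G : Graph) {k} (∣M∣≡k : ∀ v → ∣ M G v ∣ ≡ k) where

  nonDominating-suc-k : length (nonDominating G (suc k)) ≡ 0
  nonDominating-suc-k with nonDominating G (suc k) in eq
  ... | []    = refl
  ... | S ∷ _ with ∈-nonDominating⁻ G {suc k} (subst (S ∈ˡ_) (sym eq) (here refl))
  ...   | (v , S⊆M) , ∣S∣≡ = contradiction
    (subst₂ _≤_ ∣S∣≡ (∣M∣≡k v) (Sub.p⊆q⇒∣p∣≤∣q∣ S⊆M)) (ℕ.<⇒≱ (ℕ.n<1+n k))

  order≤nonDominating-k : (∀ {v w} → M G v ≡ M G w → v ≡ w) → order G ≤ length (nonDominating G k)
  order≤nonDominating-k M-inj = subst (_≤ length (nonDominating G k)) (List.length-tabulate {n = order G} id)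
    (pigeonhole-≤ (λ v S → S ≡ M G v) (Unique.allFin⁺ (order G))
      (λ {v} _ → _ , subst (λ i → M G v ∈ˡ nonDominating G i) (∣M∣≡k v) (∈-nonDominating⁺ G {M G v} id) , refl)
      (λ _ _ e e′ → M-inj (trans (sym e) e′)))

  nonDominating-2≤ : (∀ x → C G x ⊆ M G x) → length (nonDominating G 2) * 2 ≤ order G * k
  nonDominating-2≤ C⊆M = subst (_≤ order G * k) (sym (sum-pairs-at G))
    (sum-≤ λ x → subst (length (pairs-at G x) ≤_) (∣M∣≡k x) (pairs-at≤ G x (C⊆M x)))

-- In `𝒦` each `M v` lies inside one colour class, and distinct vertices of a class are
-- non-adjacent. This yields the bound on the number of non-dominating pairs.
C⊆M-𝒦 : ∀ r a x → C (𝒦 r a) x ⊆ M (𝒦 r a) x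
C⊆M-𝒦 r a x {y} y∈C with ∈⟪⟫⁻ (common? (𝒦 r a) x) y∈C
... | y≢x , v , x∈Mv , y∈Mv = ⇐ (∈M⇔′ m x y) (same-block , λ same-pos →
    y≢x (coords-injective m (cong₂ _,_ same-block same-pos)))
  where
  m = model-𝒦 r a
  same-block : proj₁ (coords m y) ≡ proj₁ (coords m x)
  same-block = trans (proj₁ (⇒ (∈M⇔′ m v y) y∈Mv)) (sym (proj₁ (⇒ (∈M⇔′ m v x) x∈Mv)))

-- From equal polynomials to a model

module _ (H : Graph) (r k : ℕ) (3≤k : 3 ≤ k) (H∼𝒦 : H ∼ᴰ 𝒦 r (suc k)) where

  private
    K : Graph
    K = 𝒦 r (suc k)

    order≡ : order H ≡ order K
    order≡ = ℕ.≤-antisym (∼ᴰ⇒order≤ H K H∼𝒦) (∼ᴰ⇒order≤ K H (λ i → sym (H∼𝒦 i)))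

    nonDominating≡ : ∀ i → length (nonDominating H (suc i)) ≡ length (nonDominating K (suc i))
    nonDominating≡ = ∼ᴰ⇒nonDominating≡ H K H∼𝒦

    nonDominating≡′ : ∀ {i} → 1 ≤ i → length (nonDominating H i) ≡ length (nonDominating K i)
    nonDominating≡′ (s≤s z≤n) = nonDominating≡ _

    1≤k : 1 ≤ k
    1≤k = ℕ.≤-trans (s≤s z≤n) 3≤k

    ∣M-K∣ : ∀ v → ∣ M K v ∣ ≡ k
    ∣M-K∣ = model⇒∣M∣≡ (model-𝒦 r (suc k)) (λ _ → refl)

    M-K-inj : ∀ {v w} → M K v ≡ M K w → v ≡ w
    M-K-inj = model⇒M-injective (model-𝒦 r (suc k)) (λ _ → refl) 1≤k

    ∣M-H∣≤k : ∀ v → ∣ M H v ∣ ≤ k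
    ∣M-H∣≤k = ∣M∣≤ H (trans (nonDominating≡ k) (nonDominating-suc-k K ∣M-K∣))

    order≤ : order H ≤ length (nonDominating H k)
    order≤ = subst₂ _≤_ (sym order≡) (sym (nonDominating≡′ 1≤k)) (order≤nonDominating-k K ∣M-K∣ M-K-inj)

    pairs≤ : length (nonDominating H 2) * 2 ≤ order H * k
    pairs≤ = subst₂ (λ l n → l * 2 ≤ n * k) (sym (nonDominating≡ 1)) (sym order≡)
      (nonDominating-2≤ K ∣M-K∣ (C⊆M-𝒦 r (suc k)))

    ∣M-H∣ : ∀ v → ∣ M H v ∣ ≡ k
    ∣M-H∣ = ∣M∣≡ H ∣M-H∣≤k order≤

    M-H-inj : ∀ {v w} → M H v ≡ M H w → v ≡ w
    M-H-inj = M-injective H ∣M-H∣≤k order≤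

    2≤k : 2 ≤ k
    2≤k = ℕ.<⇒≤ 3≤k

    ∣C-H∣ : ∀ x → ∣ C H x ∣ ≡ k
    ∣C-H∣ x = ℕ.≤-antisym (∣C∣≤ H ∣M-H∣ M-H-inj 2≤k pairs≤ x) (∣C∣≥ H ∣M-H∣ M-H-inj 2≤k x)

  ∼ᴰ⇒model : ∃[ t ] ∃[ s ] (t * 2 + s ≡ r × Model H {Fin t × Fin 2 ⊎ Fin s} swap (suc k))
  ∼ᴰ⇒model = count labelling
    where
    open Blocks 3≤k (M H) (C H) (M-sym H) (M-irrefl H) ∣M-H∣ M-H-inj
      (λ {x} y≢x x∈ y∈ → ∈⟪⟫⁺ (common? H x) (y≢x , _ , x∈ , y∈))
      (λ {x} → ∈⟪⟫⁻ (common? H x)) ∣C-H∣ using (Labelling; labelling)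

    count : Labelling → ∃[ t ] ∃[ s ] (t * 2 + s ≡ r × Model H {Fin t × Fin 2 ⊎ Fin s} swap (suc k))
    count (t , s , v , ∈M⇔v) = t , s , t*2+s≡r , record { label = v ; ∈M⇔ = ∈M⇔v }
      where
      t*2+s≡r : t * 2 + s ≡ r
      -- Both sides count vertices: the `t * 2 + s` blocks of size `suc k` exhaust `H`, whose order
      -- is that of `𝒦 r (suc k)`.
      t*2+s≡r = ℕ.*-cancelʳ-≡ (t * 2 + s) r (suc k) (trans
        (↔⇒≡ (v ↔-∘ ((↔-sym (labels↔ t s) ×-↔ ↔-id _) ↔-∘ Fin.*↔×))) order≡)

-- Matching the parameters with `J r a t`, and the two directions

t≤⌊r/2⌋ : ∀ t s → t ≤ ⌊ t * 2 + s /2⌋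
t≤⌊r/2⌋ t s = subst (_≤ ⌊ t * 2 + s /2⌋) (sym (ℕ.n≡⌊n+n/2⌋ t))
  (ℕ.⌊n/2⌋-mono (subst (_≤ t * 2 + s) (trans (ℕ.*-comm t 2) (cong (t +_) (ℕ.+-identityʳ t)))
    (ℕ.m≤m+n (t * 2) s)))

2*t≤r : ∀ {t r} → t ≤ ⌊ r /2⌋ → 2 * t ≤ r
2*t≤r {t} {r} t≤ = subst₂ _≤_ (cong (t +_) (sym (ℕ.+-identityʳ t))) (ℕ.⌊n/2⌋+⌈n/2⌉≡n r)
  (ℕ.+-mono-≤ t≤ (ℕ.≤-trans t≤ (ℕ.⌊n/2⌋≤⌈n/2⌉ r)))

models⇒∃J : ∀ H {r a} → (∃[ t ] ∃[ s ] (t * 2 + s ≡ r × Model H {Fin t × Fin 2 ⊎ Fin s} swap a)) →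
            ∃[ t ] (t ≤ ⌊ r /2⌋ × H ≅ J r a t)
models⇒∃J H {a = a} (t , s , refl , m) = t , t≤⌊r/2⌋ t s , models⇒≅ H (J (t * 2 + s) a t) m
  (subst (λ s′ → Model (J (t * 2 + s) a t) {Fin t × Fin 2 ⊎ Fin s′} swap a) r∸2t≡s
    (model-J (t * 2 + s) a t))
  where
  r∸2t≡s : (t * 2 + s) ∸ 2 * t ≡ s
  r∸2t≡s = trans (cong (t * 2 + s ∸_) (ℕ.*-comm 2 t)) (ℕ.m+n∸m≡n (t * 2) s)

≅J⇒∼ᴰ𝒦 : ∀ H {t r a} → t ≤ ⌊ r /2⌋ → H ≅ J r a t → H ∼ᴰ 𝒦 r a
≅J⇒∼ᴰ𝒦 H {t} {r} {a} t≤ H≅J = subst (λ r′ → H ∼ᴰ 𝒦 r′ a) r≡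
  (model⇒∼ᴰ H (model-resp-≅ H (J r a t) H≅J (model-J r a t)))
  where
  r≡ : t * 2 + (r ∸ 2 * t) ≡ r
  r≡ = trans (cong (_+ (r ∸ 2 * t)) (ℕ.*-comm t 2)) (ℕ.m+[n∸m]≡n (2*t≤r t≤))

theorem1p5 : ∀ (r a : ℕ) → r ≥ 2 → a ≥ r + 2 → ∀ (H : Graph) →
    H ∈ [ 𝒦 r a ] ⇔ (∃[ t ] (t ≤ ⌊ r /2⌋ × H ≅ J r a t))
theorem1p5 r zero    r≥2 a≥r+2 H = contradiction (ℕ.≤-trans (ℕ.m≤n+m 2 r) a≥r+2) λ ()
theorem1p5 r (suc k) r≥2 a≥r+2 H = mk⇔
  (λ H∼𝒦 → models⇒∃J H (∼ᴰ⇒model H r k 3≤k H∼𝒦))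
  (λ (t , t≤ , H≅J) → ≅J⇒∼ᴰ𝒦 H t≤ H≅J)
  where
  3≤k : 3 ≤ k
  -- The chain is `suc k ≥ r + 2 ≥ 4`.
  3≤k = ℕ.≤-pred (ℕ.≤-trans (ℕ.+-monoˡ-≤ 2 r≥2) a≥r+2)
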